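{- Let $w\in S_n$ be fireworks. If $\alpha\in\mathrm{supp}(\mathfrak{G}_w)$ and $|\alpha|<\deg\mathfrak{G}_w$, then there exists $\beta\in\mathrm{supp}(\mathfrak{G}_w)$ with $\alpha<\beta$ in componentwise order.
   Context: Permutations are written in one-line notation; $ws_j$ is $w$ with entries in positions $j,j+1$ swapped. With $\partial_j f=\frac{f-f(x_1,\ldots,x_{j+1},x_j,\ldots,x_n)}{x_j-x_{j+1}}$ and $\overline{\partial}_jf=\partial_j((1-x_{j+1})f)$, the Grothendieck polynomial is defined by $\mathfrak{G}_{w_0}=x_1^{n-1}x_2^{n-2}\cdots x_{n-1}$ for $w_0=n(n-1)\cdots1$ and $\mathfrak{G}_w=\overline{\partial}_j\mathfrak{G}_{ws_j}$ whenever $w(j)<w(j+1)$. $\mathrm{supp}(f)$ is the set of exponent vectors of monomials with nonzero coefficient, $\deg$ is total degree, and $|\alpha|=\alpha_1+\cdots+\alpha_n$. Componentwise order: $\alpha\le\beta$ iff $\alpha_i\le\beta_i$ for all $i$; $\alpha<\beta$ means $\alpha\le\beta$ and $\alpha\ne\beta$. A permutation is fireworks if the first elements of its decreasing runs (maximal consecutive decreasing blocks of $w(1)\cdots w(n)$) occur in increasing order. -}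

module Defs where

open import Data.Nat using (ℕ; zero; suc; _+_; _*_; _∸_; _<_; _≤_; _⊔_; _<ᵇ_; _≤ᵇ_)
open import Data.Nat.Properties using (_<?_)
open import Data.Integer as ℤ using (ℤ; +_; -_)
open import Data.Bool using (Bool; true; false; if_then_else_)
open import Data.Fin using (toℕ)
open import Data.Vec as V using (Vec; []; _∷_; tabulate; toList)
open import Data.Vec.Properties using (≡-dec)
open import Data.Vec.Relation.Binary.Pointwise.Inductive using (Pointwise)
open import Data.List as L using (List; []; _∷_; map; _++_; concatMap; filter; foldr; upTo)
open import Data.List.Relation.Unary.Linked using (Linked)
open import Data.List.Relation.Binary.Permutation.Propositional using (_↭_)
open import Data.Maybe using (Maybe; just; nothing)
open import Data.Product using (_×_; _,_; proj₁; proj₂)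
open import Relation.Nullary using (¬_; does)
open import Relation.Nullary.Decidable using (¬?)
open import Relation.Binary.PropositionalEquality using (_≡_; _≢_)
import Data.Nat as N

-- Conventions: positions are 0-based internally. Paper's position j
-- (1-based) corresponds to index j-1 here.  Exponent vectors and
-- one-line permutations are vectors of naturals of length n.

at : ∀ {n} → Vec ℕ n → ℕ → ℕ
at [] _ = 0
at (x ∷ xs) zero = x
at (x ∷ xs) (suc i) = at xs i

setAt : ∀ {n} → ℕ → ℕ → Vec ℕ n → Vec ℕ n
setAt _ _ [] = []
setAt zero v (x ∷ xs) = v ∷ xs
setAt (suc i) v (x ∷ xs) = x ∷ setAt i v xs

swapAt : ∀ {n} → ℕ → Vec ℕ n → Vec ℕ n
swapAt _ [] = []
swapAt zero (x ∷ []) = x ∷ []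
swapAt zero (x ∷ y ∷ xs) = y ∷ x ∷ xs
swapAt (suc j) (x ∷ xs) = x ∷ swapAt j xs

-- Polynomials in x_1..x_n with integer coefficients, as finite formal
-- sums of terms (coefficient, exponent vector).  Coefficients of equal
-- monomials are added by `coeff`.

Poly : ℕ → Set
Poly n = List (ℤ × Vec ℕ n)

coeff : ∀ {n} → Poly n → Vec ℕ n → ℤ
coeff [] α = + 0
coeff ((c , a) ∷ f) α with ≡-dec N._≟_ a α
... | Relation.Nullary.yes _ = c ℤ.+ coeff f α
... | Relation.Nullary.no  _ = coeff f α

_∈supp_ : ∀ {n} → Vec ℕ n → Poly n → Set
α ∈supp f = coeff f α ≢ + 0

∣_∣ₑ : ∀ {n} → Vec ℕ n → ℕ
∣ α ∣ₑ = V.sum α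

deg : ∀ {n} → Poly n → ℕ
deg f = foldr _⊔_ 0
  (map (λ t → ∣ proj₂ t ∣ₑ) (filter (λ t → ¬? (coeff f (proj₂ t) ℤ.≟ + 0)) f))

neg : ∀ {n} → Poly n → Poly n
neg = map (λ t → (ℤ.- proj₁ t) , proj₂ t)

mulVar : ∀ {n} → ℕ → Poly n → Poly n
mulVar i = map (λ t → proj₁ t , setAt i (suc (at (proj₂ t) i)) (proj₂ t))

-- divided difference ∂ on a single term c·x^a, index j (0-based):
-- (x^p y^q - x^q y^p)/(x - y) with x = x_j, y = x_{j+1}, p = a_j, q = a_{j+1}
-- = sign · Σ_{k<d} x^{m+d-1-k} y^{m+k},  m = min p q, d = |p - q|,
-- sign = + if p ≥ q, − otherwise.
ddTerm : ∀ {n} → ℕ → ℤ × Vec ℕ n → Poly n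
ddTerm j (c , a) =
  let p = at a j
      q = at a (suc j)
      m = N._⊓_ p q
      d = (p ∸ q) + (q ∸ p)
      s = if q ≤ᵇ p then c else ℤ.- c
  in map (λ k → s , setAt (suc j) (m + k) (setAt j (m + (d ∸ suc k)) a)) (upTo d)

∂ : ∀ {n} → ℕ → Poly n → Poly n
∂ j f = concatMap (ddTerm j) f

-- ∂̄_j f = ∂_j ((1 - x_{j+1}) f)   (paper indexing; 0-based here)
∂̄ : ∀ {n} → ℕ → Poly n → Poly n
∂̄ j f = ∂ j (f ++ neg (mulVar (suc j) f))

IsPerm : ∀ {n} → Vec ℕ n → Set
IsPerm {n} w = toList w ↭ map suc (upTo n)

firstAscent : ∀ {n} → Vec ℕ n → Maybe ℕ
firstAscent {n} w = L.head (filter (λ j → at w j <? at w (suc j)) (upTo (n ∸ 1)))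

topPoly : ∀ {n} → Poly n
topPoly {n} = (+ 1 , tabulate (λ i → n ∸ suc (toℕ i))) ∷ []

-- fuel-driven recursion: G_w = ∂̄_j G_{w s_j} for the first ascent j,
-- G_{w0} = topPoly.  Each step increases the length, so fuel n*n
-- always suffices to reach w0 (no ascent).
grothF : ∀ {n} → ℕ → Vec ℕ n → Poly n
grothF zero w = topPoly
grothF (suc k) w with firstAscent w
... | nothing = topPoly
... | just j = ∂̄ j (grothF k (swapAt j w))

groth : ∀ {n} → Vec ℕ n → Poly n
groth {n} w = grothF (n * n) w

-- Fireworks: first elements of the maximal decreasing runs increase.

leadersFrom : ℕ → List ℕ → List ℕ
leadersFrom p [] = []
leadersFrom p (y ∷ ys) = if p <ᵇ y then y ∷ leadersFrom y ys else leadersFrom y ys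

runLeaders : List ℕ → List ℕ
runLeaders [] = []
runLeaders (x ∷ xs) = x ∷ leadersFrom x xs

Fireworks : ∀ {n} → Vec ℕ n → Set
Fireworks w = Linked _<_ (runLeaders (toList w))

_≤ᶜ_ : ∀ {n} → Vec ℕ n → Vec ℕ n → Set
α ≤ᶜ β = Pointwise _≤_ α β

_<ᶜ_ : ∀ {n} → Vec ℕ n → Vec ℕ n → Set
α <ᶜ β = (α ≤ᶜ β) × (α ≢ β)

{-# OPTIONS --safe #-}
-- For fireworks w the support of 𝔊_w has a unique maximal element, namely the vector ρ(w) whose i-th entry
-- is the number of descents of w in positions ≥ i. Up to the signs (-1)^{|α|-ℓ(w)}, the coefficients of 𝔊_w
-- are those of the 0-Hecke expansion 𝒫_n = (1 × 𝒫_{n-1})(1 + x_1 T_1)(1 + x_2 T_2)⋯, hence never cancel; the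
-- Yang–Baxter relation shows that 𝒫 (1 + x_{j+1} T_j) is symmetric in x_j, x_{j+1}, which is the recursion by ∂̄_j.
--
-- Upper bound: along the first-ascent recursion the exponent of x_i in 𝔊_w is at most the number of entries
-- after w_i that are not left-to-right maxima of w_i w_{i+1} ⋯; for fireworks w this number is ρ(w)_i.
--
-- Lower bound: if u is w without its smallest letter, located at position k, then using exactly the factors
-- T_i with i < k (which move that letter into place) or i a descent of w (which act trivially) leads from
-- 1 × u to w, and u is again fireworks with ρ(w) - ρ(u) the indicator of these i.
module Submission where

open import Defs
open import Data.Bool using (Bool; true; false; if_then_else_; _∧_)
open import Data.Fin using (toℕ)
open import Data.Integer as ℤ using (ℤ; +_; 0ℤ; 1ℤ)
import Data.Integer.Properties as ℤₚ
import Data.Integer.Tactic.RingSolver as ℤ-Solver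
open import Data.List as List using (List; []; _∷_; map; _++_; filter; applyUpTo; upTo)
open import Data.List.Properties using (map-++; map-upTo)
import Data.List.Relation.Binary.Permutation.Setoid.Properties as Permutation
open import Data.List.Relation.Binary.Permutation.Propositional using (↭-sym; ↭⇒↭ₛ)
open import Data.List.Relation.Unary.All as ListAll using ([]; _∷_)
open import Data.List.Relation.Unary.AllPairs using ([]; _∷_)
open import Data.List.Relation.Unary.Linked using (Linked; []; _∷_)
open import Data.List.Relation.Unary.Unique.Propositional using (Unique)
open import Data.List.Relation.Unary.Unique.Propositional.Properties using (map⁺; upTo⁺)
open import Data.Maybe as Maybe using (Maybe; just; nothing)
open import Data.Nat using (ℕ; zero; suc; _+_; _*_; _∸_; _⊔_; _<_; _>_; _≤_; _<ᵇ_; _≡ᵇ_; z≤n; s≤s)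
open import Data.Nat.Properties
open import Data.Nat.Tactic.RingSolver using (solve-∀)
open import Data.Product using (Σ; ∃; _×_; _,_; proj₁; proj₂)
open import Data.Sum using (_⊎_; inj₁; inj₂)
open import Data.Vec using (Vec; []; _∷_; replicate; tabulate; toList)
open import Data.Vec.Properties using (≡-dec; tabulate-cong)
open import Data.Vec.Relation.Binary.Pointwise.Inductive as Pointwise using ([]; _∷_)
open import Data.Vec.Relation.Unary.All as All using (All; []; _∷_)
open import Data.Vec.Relation.Unary.AllPairs using (AllPairs; []; _∷_)
open import Function using (_∘_; id)
open import Relation.Binary.Definitions using (tri<; tri≈; tri>)
open import Relation.Binary.PropositionalEquality
open import Relation.Nullary using (¬_; yes; no; contradiction; does)
open import Relation.Nullary.Decidable using (¬?; dec-true; dec-false)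
open import Algebra.Properties.AbelianGroup ℤₚ.+-0-abelianGroup using (∙-cancelʳ)
open import Algebra.Properties.CommutativeSemigroup +-commutativeSemigroup using (interchange; x∙yz≈y∙xz)
open ≡-Reasoning

-- The 0-Hecke action on coefficient functions

<ᵇ-true : ∀ {m n} → m < n → (m <ᵇ n) ≡ true
<ᵇ-true {m} {n} = dec-true (m <? n)

<ᵇ-false : ∀ {m n} → ¬ m < n → (m <ᵇ n) ≡ false
<ᵇ-false {m} {n} = dec-false (m <? n)

shift : {A : Set} → A → (ℕ → A) → ℕ → A
shift z f zero = z
shift z f (suc a) = f a

-- The coefficient function of x_i · f, given the coefficient function of f.
times : {A : Set} {n : ℕ} → A → ℕ → (Vec ℕ n → A) → Vec ℕ n → A
times z i f [] = z
times z zero f (a ∷ α) = shift z (λ a′ → f (a′ ∷ α)) a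
times z (suc i) f (a ∷ α) = times z i (f ∘ (a ∷_)) α

-- Right multiplication by the j-th generator of the 0-Hecke monoid: T j f w is
-- the sum of f v over all v whose Demazure product with s_j is w.
T : ∀ {k} → ℕ → (Vec ℕ k → ℕ) → Vec ℕ k → ℕ
T zero f [] = 0
T zero f (a ∷ []) = 0
T zero f (a ∷ b ∷ w) = if b <ᵇ a then f (a ∷ b ∷ w) + f (b ∷ a ∷ w) else 0
T (suc j) f [] = 0
T (suc j) f (a ∷ w) = T j (f ∘ (a ∷_)) w

shift-cong : ∀ {A : Set} {z : A} {f g : ℕ → A} → (∀ a → f a ≡ g a) → ∀ a → shift z f a ≡ shift z g a
shift-cong e zero = refl
shift-cong e (suc a) = e a

shift-const : ∀ a → shift 0 (λ _ → 0) a ≡ 0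
shift-const zero = refl
shift-const (suc a) = refl

shift-+ : ∀ (f g : ℕ → ℕ) a → shift 0 (λ a → f a + g a) a ≡ shift 0 f a + shift 0 g a
shift-+ f g zero = refl
shift-+ f g (suc a) = refl

times-cong : ∀ {A : Set} {z : A} {n} i {f g : Vec ℕ n → A} → (∀ α → f α ≡ g α) → ∀ α → times z i f α ≡ times z i g α
times-cong i e [] = refl
times-cong zero e (a ∷ α) = shift-cong (λ a → e (a ∷ α)) a
times-cong (suc i) e (a ∷ α) = times-cong i (λ α → e (a ∷ α)) α

times-0 : ∀ {n} i (α : Vec ℕ n) → times 0 i (λ _ → 0) α ≡ 0
times-0 i [] = refl
times-0 zero (a ∷ α) = shift-const a
times-0 (suc i) (a ∷ α) = times-0 i α

times-+ : ∀ {n} i (f g : Vec ℕ n → ℕ) α → times 0 i (λ α → f α + g α) α ≡ times 0 i f α + times 0 i g α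
times-+ i f g [] = refl
times-+ zero f g (a ∷ α) = shift-+ _ _ a
times-+ (suc i) f g (a ∷ α) = times-+ i _ _ α

T-cong : ∀ {k} j {f g : Vec ℕ k → ℕ} → (∀ w → f w ≡ g w) → ∀ w → T j f w ≡ T j g w
T-cong zero e [] = refl
T-cong zero e (a ∷ []) = refl
T-cong zero e (a ∷ b ∷ w) with b <ᵇ a
... | true = cong₂ _+_ (e _) (e _)
... | false = refl
T-cong (suc j) e [] = refl
T-cong (suc j) e (a ∷ w) = T-cong j (λ w → e (a ∷ w)) w

T-0 : ∀ {k} j (w : Vec ℕ k) → T j (λ _ → 0) w ≡ 0
T-0 zero [] = refl
T-0 zero (a ∷ []) = refl
T-0 zero (a ∷ b ∷ w) with b <ᵇ a
... | true = refl
... | false = refl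
T-0 (suc j) [] = refl
T-0 (suc j) (a ∷ w) = T-0 j w

T-+ : ∀ {k} j (f g : Vec ℕ k → ℕ) w → T j (λ w → f w + g w) w ≡ T j f w + T j g w
T-+ zero f g [] = refl
T-+ zero f g (a ∷ []) = refl
T-+ zero f g (a ∷ b ∷ w) with b <ᵇ a
... | true = interchange (f (a ∷ b ∷ w)) _ _ _
... | false = refl
T-+ (suc j) f g [] = refl
T-+ (suc j) f g (a ∷ w) = T-+ j _ _ w

T-shift : ∀ {k} j (f : ℕ → Vec ℕ k → ℕ) a w → shift 0 (λ a → T j (f a) w) a ≡ T j (λ v → shift 0 (λ a → f a v) a) w
T-shift j f zero w = sym (T-0 j w)
T-shift j f (suc a) w = refl

T-times : ∀ {k n} i j (F : Vec ℕ k → Vec ℕ n → ℕ) w α →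
  times 0 i (λ α → T j (λ v → F v α) w) α ≡ T j (λ v → times 0 i (F v) α) w
T-times i j F w [] = sym (T-0 j w)
T-times zero j F w (a ∷ α) = T-shift j (λ a v → F v (a ∷ α)) a w
T-times (suc i) j F w (a ∷ α) = T-times i j (λ v α → F v (a ∷ α)) w α

-- `T 0 f` vanishes unless the first two letters descend, so the second application adds only a zero
-- summand.
T-idem : ∀ {k} (f : Vec ℕ k → ℕ) w → T 0 (T 0 f) w ≡ T 0 f w
T-idem f [] = refl
T-idem f (a ∷ []) = refl
T-idem f (a ∷ b ∷ w) with b <? a
... | no b≮a rewrite <ᵇ-false b≮a = refl
... | yes b<a rewrite <ᵇ-true b<a | <ᵇ-false (<⇒≯ b<a) = +-identityʳ _

T-idem₁ : ∀ {k} (f : Vec ℕ k → ℕ) w → T 1 (T 1 f) w ≡ T 1 f w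
T-idem₁ f [] = refl
T-idem₁ f (a ∷ w) = T-idem (f ∘ (a ∷_)) w

T-comm : ∀ {k} j (f : Vec ℕ k → ℕ) w → T (suc (suc j)) (T 0 f) w ≡ T 0 (T (suc (suc j)) f) w
T-comm j f [] = refl
T-comm j f (a ∷ []) = refl
T-comm j f (a ∷ b ∷ w) with b <ᵇ a
... | true = T-+ j _ _ w
... | false = T-0 j w

reorder : ∀ a b c d e f → ((a + b) + (c + d)) + (e + f) ≡ ((a + c) + (b + e)) + (d + f)
reorder = solve-∀

-- If the first three letters decrease strictly, both sides sum `f` over their six arrangements;
-- otherwise both are zero.
T-braid : ∀ {k} (f : Vec ℕ k → ℕ) w → T 0 (T 1 (T 0 f)) w ≡ T 1 (T 0 (T 1 f)) w
T-braid f [] = refl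
T-braid f (a ∷ []) = refl
T-braid f (a ∷ b ∷ []) with b <ᵇ a
... | true = refl
... | false = refl
T-braid f (a ∷ b ∷ c ∷ w) with b <? a | c <? b | c <? a
... | yes b<a | yes c<b | no c≮a = contradiction (<-trans c<b b<a) c≮a
... | no b≮a | no c≮b | yes c<a = contradiction (<-≤-trans c<a (≮⇒≥ b≮a)) c≮b
... | no b≮a | no c≮b | no c≮a
  rewrite <ᵇ-false b≮a | <ᵇ-false c≮b = refl
... | no b≮a | yes c<b | no c≮a
  rewrite <ᵇ-false b≮a | <ᵇ-true c<b | <ᵇ-false c≮a = refl
... | no b≮a | yes c<b | yes c<a
  rewrite <ᵇ-false b≮a | <ᵇ-true c<b | <ᵇ-true c<a | <ᵇ-false (<⇒≯ c<b) = refl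
... | yes b<a | no c≮b | no c≮a
  rewrite <ᵇ-true b<a | <ᵇ-false c≮b | <ᵇ-false c≮a = refl
... | yes b<a | no c≮b | yes c<a
  rewrite <ᵇ-true b<a | <ᵇ-false c≮b | <ᵇ-true c<a | <ᵇ-false (<⇒≯ b<a) = refl
... | yes b<a | yes c<b | yes c<a
  rewrite <ᵇ-true b<a | <ᵇ-true c<b | <ᵇ-true c<a | <ᵇ-false (<⇒≯ b<a) | <ᵇ-false (<⇒≯ c<b) =
  reorder (f (a ∷ b ∷ c ∷ w)) _ _ _ _ _

-- The Yang–Baxter relation

-- Write x, y for x_j, x_{j+1} and T, T′ for T 0, T 1. With f_{pq} the coefficient functions of x^p y^q F
-- and Σ = (1 + y T′) F, this is the operator identity
--   (1 + y T)(1 + y T′)(1 + x T) F + x y T T′ Σ = (1 + x y T′ T + (x + y + x y) T) Σ,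
-- which holds because of T T′ T = T′ T T′, T² = T and T′² = T′.
module _ {k : ℕ} (f₀₀ f₁₀ f₀₁ f₁₁ f₀₂ f₁₂ : Vec ℕ k → ℕ) where

  yb-lhs yb-cor yb-rhs : Vec ℕ k → ℕ
  yb-lhs w = f₀₀ w + T 0 f₁₀ w + T 1 (λ v → f₀₁ v + T 0 f₁₁ v) w
           + T 0 (λ v → f₀₁ v + T 0 f₁₁ v + T 1 (λ u → f₀₂ u + T 0 f₁₂ u) v) w
  yb-cor w = T 0 (T 1 (λ v → f₁₁ v + T 1 f₁₂ v)) w
  yb-rhs w = f₀₀ w + T 1 f₀₁ w + T 1 (T 0 (λ v → f₁₁ v + T 1 f₁₂ v)) w
           + T 0 (λ v → f₁₀ v + T 1 f₁₁ v) w + T 0 (λ v → f₀₁ v + T 1 f₀₂ v) w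
           + T 0 (λ v → f₁₁ v + T 1 f₁₂ v) w

  private
    rearrange : ∀ a b c d e g h i j k →
      a + b + (c + d) + (e + g + (h + i)) + (j + k) ≡
      a + c + (d + i) + (b + j) + (e + h) + (g + k)
    rearrange = solve-∀

  yang-baxter : ∀ w → yb-lhs w + yb-cor w ≡ yb-rhs w
  yang-baxter w = begin
    yb-lhs w + yb-cor w
      ≡⟨ cong₂ _+_ (cong₂ _+_ (cong (_+_ (f₀₀ w + T 0 f₁₀ w)) (T-+ 1 _ _ w)) lhs₃) cor ⟩
    f₀₀ w + T 0 f₁₀ w + (T 1 f₀₁ w + T 1 (T 0 f₁₁) w)
      + (T 0 f₀₁ w + T 0 f₁₁ w + (T 0 (T 1 f₀₂) w + T 1 (T 0 (T 1 f₁₂)) w))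
      + (T 0 (T 1 f₁₁) w + T 0 (T 1 f₁₂) w)
      ≡⟨ rearrange (f₀₀ w) _ _ _ (T 0 f₀₁ w) _ (T 0 (T 1 f₀₂) w) _ _ _ ⟩
    f₀₀ w + T 1 f₀₁ w + (T 1 (T 0 f₁₁) w + T 1 (T 0 (T 1 f₁₂)) w)
      + (T 0 f₁₀ w + T 0 (T 1 f₁₁) w) + (T 0 f₀₁ w + T 0 (T 1 f₀₂) w)
      + (T 0 f₁₁ w + T 0 (T 1 f₁₂) w)
      ≡⟨ cong₂ _+_ (cong₂ _+_ (cong₂ _+_ (cong (_+_ (f₀₀ w + T 1 f₀₁ w)) rhs₃) (T-+ 0 _ _ w)) (T-+ 0 _ _ w)) (T-+ 0 _ _ w) ⟨
    yb-rhs w ∎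
    where
    lhs₃ : T 0 (λ v → f₀₁ v + T 0 f₁₁ v + T 1 (λ u → f₀₂ u + T 0 f₁₂ u) v) w ≡
           T 0 f₀₁ w + T 0 f₁₁ w + (T 0 (T 1 f₀₂) w + T 1 (T 0 (T 1 f₁₂)) w)
    lhs₃ = begin
      _ ≡⟨ T-+ 0 _ _ w ⟩
      _ ≡⟨ cong₂ _+_ (T-+ 0 _ _ w) (trans (T-cong 0 (T-+ 1 _ _) w) (T-+ 0 _ _ w)) ⟩
      _ ≡⟨ cong₂ _+_ (cong (_+_ (T 0 f₀₁ w)) (T-idem f₁₁ w)) (cong (_+_ (T 0 (T 1 f₀₂) w)) (T-braid f₁₂ w)) ⟩
      _ ∎
    cor : yb-cor w ≡ T 0 (T 1 f₁₁) w + T 0 (T 1 f₁₂) w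
    cor = begin
      _ ≡⟨ T-cong 0 (T-+ 1 _ _) w ⟩
      _ ≡⟨ T-+ 0 _ _ w ⟩
      _ ≡⟨ cong (_+_ (T 0 (T 1 f₁₁) w)) (T-cong 0 (T-idem₁ f₁₂) w) ⟩
      _ ∎
    rhs₃ : T 1 (T 0 (λ v → f₁₁ v + T 1 f₁₂ v)) w ≡ T 1 (T 0 f₁₁) w + T 1 (T 0 (T 1 f₁₂)) w
    rhs₃ = trans (T-cong 1 (T-+ 0 _ _) w) (T-+ 1 _ _ w)

-- Φ a b is the coefficient of x^a y^b; Φ₀, Φ₁, Φ₂ result from applying 1 + x T, 1 + y T′, 1 + y T in turn, and Φₛ from 1 + y T′ alone.
module _ {k : ℕ} (Φ : ℕ → ℕ → Vec ℕ k → ℕ) where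

  Φ₀ Φ₁ Φ₂ Φₛ : ℕ → ℕ → Vec ℕ k → ℕ
  Φ₀ a b w = Φ a b w + shift 0 (λ a → T 0 (Φ a b) w) a
  Φ₁ a b w = Φ₀ a b w + shift 0 (λ b → T 1 (Φ₀ a b) w) b
  Φ₂ a b w = Φ₁ a b w + shift 0 (λ b → T 0 (Φ₁ a b) w) b
  Φₛ a b w = Φ a b w + shift 0 (λ b → T 1 (Φ a b) w) b

  private
    f₁₀ f₀₁ f₁₁ f₀₂ f₁₂ : ℕ → ℕ → Vec ℕ k → ℕ
    f₁₀ a b w = shift 0 (λ a → Φ a b w) a
    f₀₁ a b w = shift 0 (λ b → Φ a b w) b
    f₁₁ a b w = shift 0 (λ a → shift 0 (λ b → Φ a b w) b) a
    f₀₂ a b w = shift 0 (λ b → shift 0 (λ b → Φ a b w) b) b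
    f₁₂ a b w = shift 0 (λ a → shift 0 (λ b → shift 0 (λ b → Φ a b w) b) b) a

    Σ₁₀ Σ₀₁ Σ₁₁ : ℕ → ℕ → Vec ℕ k → ℕ
    Σ₁₀ a b w = shift 0 (λ a → Φₛ a b w) a
    Σ₀₁ a b w = shift 0 (λ b → Φₛ a b w) b
    Σ₁₁ a b w = shift 0 (λ a → shift 0 (λ b → Φₛ a b w) b) a

    cor rhs : ℕ → ℕ → Vec ℕ k → ℕ
    cor a b w = T 0 (T 1 (Σ₁₁ a b)) w
    rhs a b w = Φₛ a b w + T 1 (T 0 (Σ₁₁ a b)) w + T 0 (Σ₁₀ a b) w + T 0 (Σ₀₁ a b) w + T 0 (Σ₁₁ a b) w

    Σ₁₀-≡ : ∀ a b w → f₁₀ a b w + T 1 (f₁₁ a b) w ≡ Σ₁₀ a b w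
    Σ₁₀-≡ zero b w = T-0 1 w
    Σ₁₀-≡ (suc a) b w = cong (_+_ (Φ a b w)) (sym (T-shift 1 (Φ a) b w))

    Σ₀₁-≡ : ∀ a b w → f₀₁ a b w + T 1 (f₀₂ a b) w ≡ Σ₀₁ a b w
    Σ₀₁-≡ a zero w = T-0 1 w
    Σ₀₁-≡ a (suc b) w = cong (_+_ (Φ a b w)) (sym (T-shift 1 (Φ a) b w))

    Σ₁₁-≡ : ∀ a b w → f₁₁ a b w + T 1 (f₁₂ a b) w ≡ Σ₁₁ a b w
    Σ₁₁-≡ zero b w = T-0 1 w
    Σ₁₁-≡ (suc a) b w = Σ₀₁-≡ a b w

    Φ₀-≡ : ∀ a b w → Φ₀ a b w ≡ Φ a b w + T 0 (f₁₀ a b) w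
    Φ₀-≡ a b w = cong (_+_ (Φ a b w)) (T-shift 0 (λ a → Φ a b) a w)

    shift-Φ₀ : ∀ a b w → shift 0 (λ b → Φ₀ a b w) b ≡ f₀₁ a b w + T 0 (f₁₁ a b) w
    shift-Φ₀ a zero w = sym (trans (T-cong 0 (λ _ → shift-const a) w) (T-0 0 w))
    shift-Φ₀ a (suc b) w = Φ₀-≡ a b w

    Φ₁-≡ : ∀ a b w → Φ₁ a b w ≡ Φ a b w + T 0 (f₁₀ a b) w + T 1 (λ v → f₀₁ a b v + T 0 (f₁₁ a b) v) w
    Φ₁-≡ a b w = cong₂ _+_ (Φ₀-≡ a b w) (trans (T-shift 1 (Φ₀ a) b w) (T-cong 1 (shift-Φ₀ a b) w))

    shift-Φ₁ : ∀ a b w → shift 0 (λ b → Φ₁ a b w) b ≡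
      f₀₁ a b w + T 0 (f₁₁ a b) w + T 1 (λ v → f₀₂ a b v + T 0 (f₁₂ a b) v) w
    shift-Φ₁ a (suc b) w = Φ₁-≡ a b w
    shift-Φ₁ a zero w = sym (cong₂ _+_ (T-zero 0 (λ _ → shift-const a) w)
      (T-zero 1 (λ v → T-zero 0 (λ _ → shift-const a) v) w))
      where
      T-zero : ∀ j {f : Vec ℕ k → ℕ} → (∀ w → f w ≡ 0) → ∀ w → T j f w ≡ 0
      T-zero j e w = trans (T-cong j e w) (T-0 j w)

    Φ₂-≡ : ∀ a b w → Φ₂ a b w + cor a b w ≡ rhs a b w
    Φ₂-≡ a b w = begin
      Φ₂ a b w + cor a b w
        ≡⟨ cong₂ _+_ (cong₂ _+_ (Φ₁-≡ a b w) (trans (T-shift 0 (Φ₁ a) b w) (T-cong 0 (shift-Φ₁ a b) w)))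
             (T-cong 0 (T-cong 1 λ v → sym (Σ₁₁-≡ a b v)) w) ⟩
      yb-lhs (Φ a b) (f₁₀ a b) (f₀₁ a b) (f₁₁ a b) (f₀₂ a b) (f₁₂ a b) w
        + yb-cor (Φ a b) (f₁₀ a b) (f₀₁ a b) (f₁₁ a b) (f₀₂ a b) (f₁₂ a b) w
        ≡⟨ yang-baxter (Φ a b) (f₁₀ a b) (f₀₁ a b) (f₁₁ a b) (f₀₂ a b) (f₁₂ a b) w ⟩
      yb-rhs (Φ a b) (f₁₀ a b) (f₀₁ a b) (f₁₁ a b) (f₀₂ a b) (f₁₂ a b) w
        ≡⟨ cong₂ _+_ (cong₂ _+_ (cong₂ _+_ (cong₂ _+_
             (cong (_+_ (Φ a b w)) (sym (T-shift 1 (Φ a) b w)))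
             (T-cong 1 (T-cong 0 (Σ₁₁-≡ a b)) w))
             (T-cong 0 (Σ₁₀-≡ a b) w)) (T-cong 0 (Σ₀₁-≡ a b) w)) (T-cong 0 (Σ₁₁-≡ a b) w) ⟩
      rhs a b w ∎

  -- In the identity `Φ₂-≡`, both `cor` and `rhs` arise from Σ by operators symmetric in x and y, so
  -- they inherit the symmetry of Σ, and `cor` cancels.
  yang-baxter-symmetric : (∀ a b w → Φₛ a b w ≡ Φₛ b a w) → ∀ a b w → Φ₂ a b w ≡ Φ₂ b a w
  yang-baxter-symmetric s a b w = +-cancelʳ-≡ (cor a b w) _ _ (begin
    Φ₂ a b w + cor a b w ≡⟨ Φ₂-≡ a b w ⟩
    rhs a b w ≡⟨ rhs-sym ⟩
    rhs b a w ≡⟨ Φ₂-≡ b a w ⟨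
    Φ₂ b a w + cor b a w ≡⟨ cong (_+_ (Φ₂ b a w)) (T-cong 0 (T-cong 1 (Σ₁₁-sym b a)) w) ⟩
    Φ₂ b a w + cor a b w ∎)
    where
    Σ₁₀-sym : ∀ a b v → Σ₁₀ a b v ≡ Σ₀₁ b a v
    Σ₁₀-sym a b v = shift-cong (λ a → s a b v) a
    Σ₁₁-sym : ∀ a b v → Σ₁₁ a b v ≡ Σ₁₁ b a v
    Σ₁₁-sym zero zero v = refl
    Σ₁₁-sym zero (suc b) v = refl
    Σ₁₁-sym (suc a) zero v = refl
    Σ₁₁-sym (suc a) (suc b) v = s a b v
    comm : ∀ p q r s t → p + q + r + s + t ≡ p + q + s + r + t
    comm = solve-∀
    rhs-sym : rhs a b w ≡ rhs b a w
    rhs-sym = trans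
      (cong₂ _+_ (cong₂ _+_ (cong₂ _+_ (cong₂ _+_ (s a b w) (T-cong 1 (T-cong 0 (Σ₁₁-sym a b)) w))
        (T-cong 0 (Σ₁₀-sym a b) w)) (T-cong 0 (λ v → sym (Σ₁₀-sym b a v)) w)) (T-cong 0 (Σ₁₁-sym a b) w))
      (comm (Φₛ b a w) _ _ _ _)

-- One column of the 0-Hecke expansion

Family : ℕ → ℕ → Set
Family k n = Vec ℕ k → Vec ℕ n → ℕ

-- H F x a is the restriction of (1 + x₁ T₁) F to the words starting with x and the monomials containing exactly x₁^a.
H : ∀ {k n} → Family (suc k) (suc n) → ℕ → ℕ → Family k n
H F x a w α = F (x ∷ w) (a ∷ α) + shift 0 (λ a → T 0 (λ v → F v (a ∷ α)) (x ∷ w)) a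

-- Col F = F (1 + x₁ T₁) (1 + x₂ T₂) ⋯
Col : ∀ {k n} → Family k n → Family k n
Col F [] α = F [] α
Col F (x ∷ w) [] = F (x ∷ w) []
-- The later factors change neither the first letter nor the first exponent, so both can be frozen.
Col F (x ∷ w) (a ∷ α) = Col (H F x a) w α

H-cong : ∀ {k n} {F G : Family (suc k) (suc n)} → (∀ w α → F w α ≡ G w α) → ∀ x a w α → H F x a w α ≡ H G x a w α
H-cong e x a w α = cong₂ _+_ (e _ _) (shift-cong (λ a → T-cong 0 (λ v → e v (a ∷ α)) (x ∷ w)) a)

Col-cong : ∀ {k n} {F G : Family k n} → (∀ w α → F w α ≡ G w α) → ∀ w α → Col F w α ≡ Col G w α
Col-cong e [] α = e [] α
Col-cong e (x ∷ w) [] = e (x ∷ w) []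
Col-cong e (x ∷ w) (a ∷ α) = Col-cong (H-cong e x a) w α

H-+ : ∀ {k n} (F G : Family (suc k) (suc n)) x a w α →
  H (λ w α → F w α + G w α) x a w α ≡ H F x a w α + H G x a w α
H-+ F G x a w α = begin
  _ ≡⟨ cong (_+_ (F (x ∷ w) (a ∷ α) + G (x ∷ w) (a ∷ α))) (trans (shift-cong (λ a → T-+ 0 _ _ (x ∷ w)) a) (shift-+ _ _ a)) ⟩
  _ ≡⟨ interchange (F (x ∷ w) (a ∷ α)) _ _ _ ⟩
  _ ∎

Col-+ : ∀ {k n} (F G : Family k n) w α → Col (λ w α → F w α + G w α) w α ≡ Col F w α + Col G w α
Col-+ F G [] α = refl
Col-+ F G (x ∷ w) [] = refl
Col-+ F G (x ∷ w) (a ∷ α) = trans (Col-cong (H-+ F G x a) w α) (Col-+ (H F x a) (H G x a) w α)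

Col-0 : ∀ {k n} (w : Vec ℕ k) (α : Vec ℕ n) → Col (λ _ _ → 0) w α ≡ 0
Col-0 [] α = refl
Col-0 (x ∷ w) [] = refl
Col-0 (x ∷ w) (a ∷ α) = trans (Col-cong (λ w _ → trans (shift-cong (λ _ → T-0 0 (x ∷ w)) a) (shift-const a)) w α) (Col-0 w α)

Col-if : ∀ {k n} b (F : Family k n) w α → Col (λ w α → if b then F w α else 0) w α ≡ (if b then Col F w α else 0)
Col-if true F w α = refl
Col-if false F w α = Col-0 w α

Col-shift : ∀ {k n} (F : ℕ → Family k n) b w α → Col (λ w α → shift 0 (λ b → F b w α) b) w α ≡ shift 0 (λ b → Col (F b) w α) b
Col-shift F zero w α = Col-0 w α
Col-shift F (suc b) w α = refl

-- The product F (1 + x_{j+1} T_i).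
times-T : ∀ {k n} → ℕ → ℕ → Family k n → Family k n
times-T j i F w α = F w α + T i (λ v → times 0 (suc j) (F v) α) w

Symmetric-at : ∀ {k n} → ℕ → Family k n → Set
Symmetric-at j F = ∀ w α → F w α ≡ F w (swapAt j α)

times-H : ∀ {k n} i (F : Family (suc k) (suc n)) x a w α →
  times 0 i (H F x a w) α ≡ H (λ v → times 0 (suc i) (F v)) x a w α
times-H i F x zero w α = trans (times-+ i _ _ α) (cong (_+_ (times 0 i (λ α → F (x ∷ w) (0 ∷ α)) α)) (times-0 i α))
times-H i F x (suc a) w α = trans (times-+ i _ _ α) (cong (_+_ (times 0 i (λ α → F (x ∷ w) (suc a ∷ α)) α)) (T-times i 0 (λ v α → F v (a ∷ α)) (x ∷ w) α))

T-H : ∀ {k n} j (F : Family (suc k) (suc n)) x a w α →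
  T (suc j) (λ v → H F x a v α) w ≡ H (λ v α → T (suc (suc j)) (λ u → F u α) v) x a w α
T-H j F x zero w α = trans (T-+ (suc j) _ _ w) (cong (_+_ (T (suc j) (λ v → F (x ∷ v) (0 ∷ α)) w)) (T-0 (suc j) w))
T-H j F x (suc a) w α = trans (T-+ (suc j) _ _ w)
  (cong (_+_ (T (suc j) (λ v → F (x ∷ v) (suc a ∷ α)) w)) (T-comm j (λ v → F v (a ∷ α)) (x ∷ w)))

times-T-H : ∀ {k n} j (F : Family (suc k) (suc n)) x a w α →
  times-T j (suc j) (H F x a) w α ≡ H (times-T (suc j) (suc (suc j)) F) x a w α
times-T-H j F x a w α = begin
  H F x a w α + T (suc j) (λ v → times 0 (suc j) (H F x a v) α) w
    ≡⟨ cong (_+_ (H F x a w α)) (T-cong (suc j) (λ v → times-H (suc j) F x a v α) w) ⟩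
  H F x a w α + T (suc j) (λ v → H (λ u → times 0 (suc (suc j)) (F u)) x a v α) w
    ≡⟨ cong (_+_ (H F x a w α)) (T-H j (λ u → times 0 (suc (suc j)) (F u)) x a w α) ⟩
  H F x a w α + H (λ v α → T (suc (suc j)) (λ u → times 0 (suc (suc j)) (F u) α) v) x a w α
    ≡⟨ H-+ F (λ v α → T (suc (suc j)) (λ u → times 0 (suc (suc j)) (F u) α) v) x a w α ⟨
  H (times-T (suc j) (suc (suc j)) F) x a w α ∎

-- For positive `j` the first factor of the column commutes with the factor in the hypothesis and is
-- peeled off. For `j` = 0 the first two factors of the column followed by 1 + y T are the product
-- in the Yang-Baxter relation, and the hypothesis is the symmetry of Σ.
Col-symmetric : ∀ {k n} j (F : Family k n) → Symmetric-at j (times-T j (suc j) F) → Symmetric-at j (times-T j j (Col F))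
Col-symmetric zero F s w [] = refl
Col-symmetric zero F s w (a ∷ []) = refl
Col-symmetric zero F s [] (a ∷ b ∷ α) = s [] (a ∷ b ∷ α)
Col-symmetric zero F s (x ∷ []) (a ∷ b ∷ α) = begin
  _ ≡⟨ cong (λ z → F (x ∷ []) (a ∷ b ∷ α) + z + 0) (shift-const a) ⟩
  F (x ∷ []) (a ∷ b ∷ α) + 0 + 0 ≡⟨ cong (_+ 0) (s (x ∷ []) (a ∷ b ∷ α)) ⟩
  F (x ∷ []) (b ∷ a ∷ α) + 0 + 0 ≡⟨ cong (λ z → F (x ∷ []) (b ∷ a ∷ α) + z + 0) (shift-const b) ⟨
  _ ∎
Col-symmetric zero F s (x ∷ y ∷ w) (a ∷ b ∷ α) =
  trans (unfold a b) (trans (Col-cong (λ w α → yang-baxter-symmetric (Φ α) (hyp α) a b (x ∷ y ∷ w)) w α) (sym (unfold b a)))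
  where
  Φ : Vec ℕ _ → ℕ → ℕ → Vec ℕ _ → ℕ
  Φ α a b v = F v (a ∷ b ∷ α)

  hyp : ∀ α a b w → Φₛ (Φ α) a b w ≡ Φₛ (Φ α) b a w
  hyp α a b w = trans (to a b) (trans (s w (a ∷ b ∷ α)) (sym (to b a)))
    where
    to : ∀ a b → Φₛ (Φ α) a b w ≡ times-T 0 1 F w (a ∷ b ∷ α)
    to a b = cong (_+_ (F w (a ∷ b ∷ α))) (T-shift 1 (Φ α a) b w)

  -- The extra factor concerns only the first two letters and the second exponent, so it may be
  -- applied before the remaining factors of the column.
  unfold : ∀ a b → times-T 0 0 (Col F) (x ∷ y ∷ w) (a ∷ b ∷ α) ≡ Col (λ w α → Φ₂ (Φ α) a b (x ∷ y ∷ w)) w α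
  unfold a b = sym (trans (Col-+ _ _ w α) (cong (_+_ (Col F (x ∷ y ∷ w) (a ∷ b ∷ α))) (begin
    Col (λ w α → shift 0 (λ b → T 0 (Φ₁ (Φ α) a b) (x ∷ y ∷ w)) b) w α
      ≡⟨ Col-cong (λ w α → T-shift 0 (Φ₁ (Φ α) a) b (x ∷ y ∷ w)) w α ⟩
    Col (λ w α → if y <ᵇ x then S x y w α + S y x w α else 0) w α
      ≡⟨ Col-if (y <ᵇ x) _ w α ⟩
    (if y <ᵇ x then Col (λ w α → S x y w α + S y x w α) w α else 0)
      ≡⟨ cong (if y <ᵇ x then_else 0) (trans (Col-+ _ _ w α) (cong₂ _+_ (Col-shift _ b w α) (Col-shift _ b w α))) ⟩
    T 0 (λ v → times 0 1 (Col F v) (a ∷ b ∷ α)) (x ∷ y ∷ w) ∎)))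
    where
    S : ∀ p q → Family _ _
    S p q w α = shift 0 (λ b → Φ₁ (Φ α) a b (p ∷ q ∷ w)) b
Col-symmetric (suc j) F s w [] = refl
Col-symmetric (suc j) F s [] (a ∷ α) = s [] (a ∷ α)
Col-symmetric (suc j) F s (x ∷ w) (a ∷ α) = Col-symmetric j (H F x a)
  (λ w α → trans (times-T-H j F x a w α) (trans (H-symm w α) (sym (times-T-H j F x a w (swapAt j α))))) w α
  where
  H-symm : ∀ w α → H (times-T (suc j) (suc (suc j)) F) x a w α ≡ H (times-T (suc j) (suc (suc j)) F) x a w (swapAt j α)
  H-symm w α = cong₂ _+_ (s _ _) (shift-cong (λ a → T-cong 0 (λ v → s v (a ∷ α)) (x ∷ w)) a)

-- The unsigned Grothendieck polynomials

below : ∀ {k} → ℕ → Vec ℕ k → Bool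
below v [] = true
below v (x ∷ u) = (v <ᵇ x) ∧ below v u

-- The image of F under 1 × – : S_k → S_{k+1}; the new smallest letter need not be 0.
ι : ∀ {k n} → Family k n → Family (suc k) n
ι F (v ∷ u) α = if below v u then F u α else 0

indicator : ∀ {n} → Vec ℕ n → Vec ℕ n → ℕ
indicator [] [] = 1
indicator (a ∷ v) (b ∷ α) = if a ≡ᵇ b then indicator v α else 0

-- The coefficients of the Grothendieck polynomials up to sign, from
-- 𝔊 = (1 × 𝔊′) (1 + x₁ T₁) (1 + x₂ T₂) ⋯ in the 0-Hecke algebra.
P : ∀ {n} k → Family k n
P zero w α = indicator (replicate _ 0) α
P (suc k) = Col (ι (P k))

∧-swap : ∀ p q r → (p ∧ (q ∧ r)) ≡ (q ∧ (p ∧ r))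
∧-swap true true r = refl
∧-swap true false r = refl
∧-swap false true r = refl
∧-swap false false r = refl

below-swapAt : ∀ {k} v j (u : Vec ℕ k) → below v (swapAt j u) ≡ below v u
below-swapAt v zero [] = refl
below-swapAt v zero (x ∷ []) = refl
below-swapAt v zero (x ∷ y ∷ u) = ∧-swap (v <ᵇ y) (v <ᵇ x) _
below-swapAt v (suc j) [] = refl
below-swapAt v (suc j) (x ∷ u) = cong ((v <ᵇ x) ∧_) (below-swapAt v j u)

if-+ : ∀ b m n → (if b then m else 0) + (if b then n else 0) ≡ (if b then m + n else 0)
if-+ true m n = refl
if-+ false m n = refl

T-if : ∀ {k} j (χ : Vec ℕ k → Bool) (f : Vec ℕ k → ℕ) → (∀ u → χ (swapAt j u) ≡ χ u) →
  ∀ u → T j (λ u → if χ u then f u else 0) u ≡ (if χ u then T j f u else 0)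
T-if zero χ f inv [] with χ []
... | true = refl
... | false = refl
T-if zero χ f inv (a ∷ []) with χ (a ∷ [])
... | true = refl
... | false = refl
T-if zero χ f inv (a ∷ b ∷ u) rewrite inv (a ∷ b ∷ u) with b <ᵇ a | χ (a ∷ b ∷ u)
... | true | true = refl
... | true | false = refl
... | false | true = refl
... | false | false = refl
T-if (suc j) χ f inv [] with χ []
... | true = refl
... | false = refl
T-if (suc j) χ f inv (a ∷ u) = T-if j (χ ∘ (a ∷_)) (f ∘ (a ∷_)) (λ u → inv (a ∷ u)) u

times-if : ∀ {n} i b (f : Vec ℕ n → ℕ) α → times 0 i (λ α → if b then f α else 0) α ≡ (if b then times 0 i f α else 0)
times-if i true f α = refl
times-if i false f α = times-0 i α

times-T-ι : ∀ {k n} j (F : Family k n) v u α → times-T j (suc j) (ι F) (v ∷ u) α ≡ (if below v u then times-T j j F u α else 0)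
times-T-ι j F v u α = begin
  ι F (v ∷ u) α + T j (λ u → times 0 (suc j) (ι F (v ∷ u)) α) u
    ≡⟨ cong (_+_ (ι F (v ∷ u) α)) (T-cong j (λ u → times-if (suc j) (below v u) (F u) α) u) ⟩
  ι F (v ∷ u) α + T j (λ u → if below v u then times 0 (suc j) (F u) α else 0) u
    ≡⟨ cong (_+_ (ι F (v ∷ u) α)) (T-if j (below v) _ (below-swapAt v j) u) ⟩
  _ ≡⟨ if-+ (below v u) _ _ ⟩
  _ ∎

indicator-0-swapAt : ∀ {n} j (α : Vec ℕ n) → indicator (replicate n 0) α ≡ indicator (replicate n 0) (swapAt j α)
indicator-0-swapAt zero [] = refl
indicator-0-swapAt zero (a ∷ []) = refl
indicator-0-swapAt zero (zero ∷ zero ∷ α) = refl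
indicator-0-swapAt zero (zero ∷ suc b ∷ α) = refl
indicator-0-swapAt zero (suc a ∷ zero ∷ α) = refl
indicator-0-swapAt zero (suc a ∷ suc b ∷ α) = refl
indicator-0-swapAt (suc j) [] = refl
indicator-0-swapAt (suc j) (zero ∷ α) = indicator-0-swapAt j α
indicator-0-swapAt (suc j) (suc a ∷ α) = refl

-- Prepending a letter by `ι` raises the index of the generator by one, which is the shift in the
-- hypothesis of `Col-symmetric`. On the empty word every `T` vanishes and P is the constant 1.
P-symmetric : ∀ {n} k j → Symmetric-at {k} {n} j (times-T j j (P k))
P-symmetric zero zero [] α = cong (_+ 0) (indicator-0-swapAt zero α)
P-symmetric zero (suc j) [] α = cong (_+ 0) (indicator-0-swapAt (suc j) α)
P-symmetric (suc k) j = Col-symmetric j (ι (P k)) λ where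
  (v ∷ u) α → trans (times-T-ι j (P k) v u α)
    (trans (cong (if below v u then_else 0) (P-symmetric k j u α)) (sym (times-T-ι j (P k) v u (swapAt j α))))

-- Decreasing words and the staircase monomial

Decreasing Distinct : ∀ {k} → Vec ℕ k → Set
Decreasing = AllPairs _>_
Distinct = AllPairs _≢_

dropLast : ∀ {k} → Vec ℕ (suc k) → Vec ℕ k
dropLast (x ∷ []) = []
dropLast (x ∷ y ∷ w) = x ∷ dropLast (y ∷ w)

All-dropLast : ∀ {k} {Q : ℕ → Set} {w : Vec ℕ (suc k)} → All Q w → All Q (dropLast w)
All-dropLast (p ∷ []) = []
All-dropLast (p ∷ q ∷ ps) = p ∷ All-dropLast (q ∷ ps)

Decreasing-dropLast : ∀ {k} {w : Vec ℕ (suc k)} → Decreasing w → Decreasing (dropLast w)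
Decreasing-dropLast (p ∷ []) = []
Decreasing-dropLast (p ∷ q ∷ ps) = All-dropLast p ∷ Decreasing-dropLast (q ∷ ps)

-- The coefficient function of x₁ ⋯ x_k · g.
times-first : ∀ {n} → ℕ → (Vec ℕ n → ℕ) → Vec ℕ n → ℕ
times-first zero g α = g α
times-first (suc k) g [] = 0
times-first (suc k) g (a ∷ α) = shift 0 (λ a → times-first k (g ∘ (a ∷_)) α) a

times-first-0 : ∀ {n} k (α : Vec ℕ n) → times-first k (λ _ → 0) α ≡ 0
times-first-0 zero α = refl
times-first-0 (suc k) [] = refl
times-first-0 (suc k) (zero ∷ α) = refl
times-first-0 (suc k) (suc a ∷ α) = times-first-0 k α

-- `Col F w` evaluates `F` only at rearrangements of `w`.
Col-cong-below : ∀ {k n} {F G : Family k n} x → (∀ w α → All (x >_) w → F w α ≡ G w α) →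
  ∀ w α → All (x >_) w → Col F w α ≡ Col G w α
Col-cong-below x e [] α p = e [] α p
Col-cong-below x e (y ∷ w) [] p = e (y ∷ w) [] p
Col-cong-below {F = F} {G} x e (y ∷ w) (a ∷ α) (y<x ∷ p) = Col-cong-below x H-≡ w α p
  where
  T-≡ : ∀ {m} (f g : Vec ℕ (suc m) → ℕ) → (∀ w → All (x >_) w → f w ≡ g w) → ∀ w → All (x >_) w → T 0 f (y ∷ w) ≡ T 0 g (y ∷ w)
  T-≡ f g e [] p = refl
  T-≡ f g e (z ∷ w) (z<x ∷ p) with z <ᵇ y
  ... | true = cong₂ _+_ (e _ (y<x ∷ z<x ∷ p)) (e _ (z<x ∷ y<x ∷ p))
  ... | false = refl
  H-≡ : ∀ w α → All (x >_) w → H F y a w α ≡ H G y a w α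
  H-≡ w α p = cong₂ _+_ (e _ _ (y<x ∷ p)) (shift-cong (λ a → T-≡ _ _ (λ w p → e w (a ∷ α) p) w p) a)

-- `ι G` vanishes on words that start with the largest letter, so the first factor must contribute
-- x₁ T₁, and this must have exchanged `x` with a smaller first letter.
Col-ι-∷ : ∀ {k n} (G : Family (suc k) (suc n)) x y w a α → All (x >_) (y ∷ w) →
  Col (ι G) (x ∷ y ∷ w) (a ∷ α) ≡ shift 0 (λ a → Col (ι (λ u α → G (x ∷ u) (a ∷ α))) (y ∷ w) α) a
Col-ι-∷ G x y w a α p = begin
  Col (H (ι G) x a) (y ∷ w) α ≡⟨ Col-cong-below x H-≡ (y ∷ w) α p ⟩
  Col (λ v α → shift 0 (λ a → ι (λ u α → G (x ∷ u) (a ∷ α)) v α) a) (y ∷ w) α ≡⟨ Col-shift _ a (y ∷ w) α ⟩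
  shift 0 (λ a → Col (ι (λ u α → G (x ∷ u) (a ∷ α))) (y ∷ w) α) a ∎
  where
  H-≡ : ∀ v α → All (x >_) v → H (ι G) x a v α ≡ shift 0 (λ a → ι (λ u α → G (x ∷ u) (a ∷ α)) v α) a
  H-≡ (z ∷ u) α (z<x ∷ _) rewrite <ᵇ-false (<⇒≯ z<x) | <ᵇ-true z<x = refl

-- The smallest letter starts in front and has to end up last. This takes all `k` generators in turn
-- and yields x₁ ⋯ x_k.
Col-ι-decreasing : ∀ {k n} (G : Family k n) w α → Decreasing w → Col (ι G) w α ≡ times-first k (G (dropLast w)) α
Col-ι-decreasing G (x ∷ []) [] d = refl
Col-ι-decreasing G (x ∷ []) (a ∷ α) d = trans (cong (_+_ (G [] (a ∷ α))) (shift-const a)) (+-identityʳ _)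
Col-ι-decreasing G (x ∷ y ∷ w) [] ((y<x ∷ _) ∷ _) rewrite <ᵇ-false (<⇒≯ y<x) = refl
Col-ι-decreasing G (x ∷ y ∷ w) (a ∷ α) (p ∷ d) =
  trans (Col-ι-∷ G x y w a α p) (shift-cong (λ a → Col-ι-decreasing (λ u α → G (x ∷ u) (a ∷ α)) (y ∷ w) α d) a)

-- The exponents of x₁^{k-1} x₂^{k-2} ⋯, padded with zeros because the number of variables stays
-- fixed while the words grow.
staircase : ℕ → ∀ n → Vec ℕ n
staircase k zero = []
staircase k (suc n) = k ∸ 1 ∷ staircase (k ∸ 1) n

staircase-0 : ∀ n → staircase 0 n ≡ replicate n 0
staircase-0 zero = refl
staircase-0 (suc n) = cong (0 ∷_) (staircase-0 n)

times-first-staircase : ∀ {n} k (α : Vec ℕ n) → k ≤ n →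
  times-first k (indicator (staircase k n)) α ≡ indicator (staircase (suc k) n) α
times-first-staircase {zero} zero α _ = refl
times-first-staircase {suc n} zero (a ∷ α) _ = refl
times-first-staircase (suc k) (zero ∷ α) _ = refl
times-first-staircase (suc k) (suc a ∷ α) (s≤s k≤n) with k ≡ᵇ a
... | true = times-first-staircase k α k≤n
... | false = times-first-0 k α

P-decreasing : ∀ {n} k w (α : Vec ℕ n) → k ≤ n → Decreasing w → P k w α ≡ indicator (staircase k n) α
P-decreasing zero [] α _ _ = cong (λ v → indicator v α) (sym (staircase-0 _))
P-decreasing (suc k) w α k<n d = begin
  Col (ι (P k)) w α ≡⟨ Col-ι-decreasing (P k) w α d ⟩
  times-first k (P k (dropLast w)) α ≡⟨ times-first-cong k (λ α → P-decreasing k (dropLast w) α (<⇒≤ k<n) (Decreasing-dropLast d)) α ⟩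
  times-first k (indicator (staircase k _)) α ≡⟨ times-first-staircase k α (<⇒≤ k<n) ⟩
  indicator (staircase (suc k) _) α ∎
  where
  times-first-cong : ∀ {n} k {f g : Vec ℕ n → ℕ} → (∀ α → f α ≡ g α) → ∀ α → times-first k f α ≡ times-first k g α
  times-first-cong zero e α = e α
  times-first-cong (suc k) e [] = refl
  times-first-cong (suc k) e (a ∷ α) = shift-cong (λ a → times-first-cong k (λ α → e (a ∷ α)) α) a

-- Coefficients of divided differences

times-zip : ∀ {A B C : Set} (h : A → B → C) {z z′ n} i (f : Vec ℕ n → A) (g : Vec ℕ n → B) α →
  times (h z z′) i (λ α → h (f α) (g α)) α ≡ h (times z i f α) (times z′ i g α)
times-zip h i f g [] = refl
times-zip h zero f g (zero ∷ α) = refl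
times-zip h zero f g (suc a ∷ α) = refl
times-zip h (suc i) f g (a ∷ α) = times-zip h i _ _ α

indicator-refl : ∀ {n} (a : Vec ℕ n) → indicator a a ≡ 1
indicator-refl [] = refl
indicator-refl (x ∷ a) rewrite dec-true (x ≟ x) refl = indicator-refl a

indicator-≢ : ∀ {n} (a α : Vec ℕ n) → a ≢ α → indicator a α ≡ 0
indicator-≢ [] [] a≢α = contradiction refl a≢α
indicator-≢ (x ∷ a) (y ∷ α) a≢α with x ≟ y
... | yes refl rewrite dec-true (x ≟ x) refl = indicator-≢ a α (a≢α ∘ cong (x ∷_))
... | no x≢y rewrite dec-false (x ≟ y) x≢y = refl

indicator-swapAt : ∀ {n} j (a α : Vec ℕ n) → indicator a (swapAt j α) ≡ indicator (swapAt j a) α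
indicator-swapAt zero [] [] = refl
indicator-swapAt zero (x ∷ []) (y ∷ []) = refl
indicator-swapAt zero (x ∷ x′ ∷ a) (y ∷ y′ ∷ α) with x ≡ᵇ y′ | x′ ≡ᵇ y
... | true | true = refl
... | true | false = refl
... | false | true = refl
... | false | false = refl
indicator-swapAt (suc j) [] [] = refl
indicator-swapAt (suc j) (x ∷ a) (y ∷ α) = cong (if x ≡ᵇ y then_else 0) (indicator-swapAt j a α)

times-indicator : ∀ {n i} → i < n → (a α : Vec ℕ n) → times 0 i (indicator a) α ≡ indicator (setAt i (suc (at a i)) a) α
times-indicator {i = zero} _ (x ∷ a) (zero ∷ α) = refl
times-indicator {i = zero} _ (x ∷ a) (suc y ∷ α) = refl
times-indicator {i = suc i} (s≤s i<n) (x ∷ a) (y ∷ α) with x ≡ᵇ y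
... | true = times-indicator i<n a α
... | false = times-0 i α

coeff-∷ : ∀ {n} c a (f : Poly n) α → coeff ((c , a) ∷ f) α ≡ c ℤ.* + indicator a α ℤ.+ coeff f α
coeff-∷ c a f α with ≡-dec _≟_ a α
... | yes refl rewrite indicator-refl a = cong (ℤ._+ coeff f a) (sym (ℤₚ.*-identityʳ c))
... | no a≢α rewrite indicator-≢ a α a≢α = sym (trans (cong (ℤ._+ coeff f α) (ℤₚ.*-zeroʳ c)) (ℤₚ.+-identityˡ _))

coeff-++ : ∀ {n} (f g : Poly n) α → coeff (f ++ g) α ≡ coeff f α ℤ.+ coeff g α
coeff-++ [] g α = sym (ℤₚ.+-identityˡ _)
coeff-++ ((c , a) ∷ f) g α = begin
  coeff ((c , a) ∷ (f ++ g)) α ≡⟨ coeff-∷ c a (f ++ g) α ⟩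
  c ℤ.* + indicator a α ℤ.+ coeff (f ++ g) α ≡⟨ cong (ℤ._+_ (c ℤ.* + indicator a α)) (coeff-++ f g α) ⟩
  c ℤ.* + indicator a α ℤ.+ (coeff f α ℤ.+ coeff g α) ≡⟨ ℤₚ.+-assoc (c ℤ.* + indicator a α) _ _ ⟨
  c ℤ.* + indicator a α ℤ.+ coeff f α ℤ.+ coeff g α ≡⟨ cong (ℤ._+ coeff g α) (coeff-∷ c a f α) ⟨
  coeff ((c , a) ∷ f) α ℤ.+ coeff g α ∎

coeff-neg : ∀ {n} (f : Poly n) α → coeff (neg f) α ≡ ℤ.- coeff f α
coeff-neg [] α = refl
coeff-neg ((c , a) ∷ f) α = begin
  _ ≡⟨ coeff-∷ (ℤ.- c) a (neg f) α ⟩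
  ℤ.- c ℤ.* + indicator a α ℤ.+ coeff (neg f) α ≡⟨ cong (ℤ._+_ (ℤ.- c ℤ.* + indicator a α)) (coeff-neg f α) ⟩
  ℤ.- c ℤ.* + indicator a α ℤ.+ ℤ.- coeff f α ≡⟨ distr c (+ indicator a α) (coeff f α) ⟩
  ℤ.- (c ℤ.* + indicator a α ℤ.+ coeff f α) ≡⟨ cong ℤ.-_ (coeff-∷ c a f α) ⟨
  _ ∎
  where
  distr : ∀ c i f → ℤ.- c ℤ.* i ℤ.+ ℤ.- f ≡ ℤ.- (c ℤ.* i ℤ.+ f)
  distr = ℤ-Solver.solve-∀

coeff-mulVar : ∀ {n i} → i < n → (f : Poly n) → ∀ α → coeff (mulVar i f) α ≡ times 0ℤ i (coeff f) α
coeff-mulVar {i = i} i<n [] α = sym (times-0ℤ i α)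
  where
  times-0ℤ : ∀ {n} i (α : Vec ℕ n) → times 0ℤ i (λ _ → 0ℤ) α ≡ 0ℤ
  times-0ℤ i [] = refl
  times-0ℤ zero (zero ∷ α) = refl
  times-0ℤ zero (suc a ∷ α) = refl
  times-0ℤ (suc i) (a ∷ α) = times-0ℤ i α
coeff-mulVar {i = i} i<n ((c , a) ∷ f) α = begin
  _ ≡⟨ coeff-∷ c (setAt i (suc (at a i)) a) (mulVar i f) α ⟩
  c ℤ.* + indicator (setAt i (suc (at a i)) a) α ℤ.+ coeff (mulVar i f) α
    ≡⟨ cong₂ (λ m z → c ℤ.* + m ℤ.+ z) (sym (times-indicator i<n a α)) (coeff-mulVar i<n f α) ⟩
  c ℤ.* + times 0 i (indicator a) α ℤ.+ times 0ℤ i (coeff f) α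
    ≡⟨ times-zip (λ m z → c ℤ.* + m ℤ.+ z) i (indicator a) (coeff f) α ⟨
  times (c ℤ.* 0ℤ ℤ.+ 0ℤ) i (λ α → c ℤ.* + indicator a α ℤ.+ coeff f α) α
    ≡⟨ cong (λ z → times z i (λ α → c ℤ.* + indicator a α ℤ.+ coeff f α) α) (trans (ℤₚ.+-identityʳ _) (ℤₚ.*-zeroʳ c)) ⟩
  times 0ℤ i (λ α → c ℤ.* + indicator a α ℤ.+ coeff f α) α
    ≡⟨ times-cong i (λ α → sym (coeff-∷ c a f α)) α ⟩
  times 0ℤ i (coeff ((c , a) ∷ f)) α ∎

setPair : ∀ {n} → ℕ → ℕ → ℕ → Vec ℕ n → Vec ℕ n
setPair j p q a = setAt (suc j) q (setAt j p a)

mulVar-setPair : ∀ {n} j p q (a : Vec ℕ n) → suc j < n →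
  setAt j (suc (at (setPair j p q a) j)) (setPair j p q a) ≡ setPair j (suc p) q a
mulVar-setPair zero p q (x ∷ y ∷ a) _ = refl
mulVar-setPair zero p q (x ∷ []) (s≤s ())
mulVar-setPair (suc j) p q (x ∷ a) (s≤s j<n) = cong (x ∷_) (mulVar-setPair j p q a j<n)

mulVar-suc-setPair : ∀ {n} j p q (a : Vec ℕ n) → suc j < n →
  setAt (suc j) (suc (at (setPair j p q a) (suc j))) (setPair j p q a) ≡ setPair j p (suc q) a
mulVar-suc-setPair zero p q (x ∷ y ∷ a) _ = refl
mulVar-suc-setPair zero p q (x ∷ []) (s≤s ())
mulVar-suc-setPair (suc j) p q (x ∷ a) (s≤s j<n) = cong (x ∷_) (mulVar-suc-setPair j p q a j<n)

setPair-at : ∀ {n} j (a : Vec ℕ n) → setPair j (at a j) (at a (suc j)) a ≡ a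
setPair-at zero [] = refl
setPair-at zero (x ∷ []) = refl
setPair-at zero (x ∷ y ∷ a) = refl
setPair-at (suc j) [] = refl
setPair-at (suc j) (x ∷ a) = cong (x ∷_) (setPair-at j a)

setPair-swap : ∀ {n} j (a : Vec ℕ n) → suc j < n → setPair j (at a (suc j)) (at a j) a ≡ swapAt j a
setPair-swap zero (x ∷ y ∷ a) _ = refl
setPair-swap zero (x ∷ []) (s≤s ())
setPair-swap (suc j) (x ∷ a) (s≤s j<n) = cong (x ∷_) (setPair-swap j a j<n)

-- The coefficient of x^α in (x_j - x_{j+1}) · f.
timesDiff : ∀ {n} → ℕ → (Vec ℕ n → ℤ) → Vec ℕ n → ℤ
timesDiff j f α = times 0ℤ j f α ℤ.- times 0ℤ (suc j) f α

module _ {n : ℕ} (j : ℕ) (j<n : suc j < n) where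

  -- The counterpart of `timesDiff` on lists of terms, where the geometric sums in `ddTerm` can be
  -- telescoped.
  mulDiff : Poly n → Vec ℕ n → ℤ
  mulDiff f α = coeff (mulVar j f) α ℤ.- coeff (mulVar (suc j) f) α

  mulDiff-timesDiff : ∀ f α → mulDiff f α ≡ timesDiff j (coeff f) α
  mulDiff-timesDiff f α = cong₂ ℤ._-_ (coeff-mulVar (<⇒≤ j<n) f α) (coeff-mulVar j<n f α)

  mulDiff-++ : ∀ f g α → mulDiff (f ++ g) α ≡ mulDiff f α ℤ.+ mulDiff g α
  mulDiff-++ f g α = trans
    (cong₂ ℤ._-_ (trans (cong (λ h → coeff h α) (map-++ _ f g)) (coeff-++ (mulVar j f) _ α))
                 (trans (cong (λ h → coeff h α) (map-++ _ f g)) (coeff-++ (mulVar (suc j) f) _ α)))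
    (rearrange (coeff (mulVar j f) α) _ _ _)
    where
    rearrange : ∀ p q r s → (p ℤ.+ q) ℤ.- (r ℤ.+ s) ≡ (p ℤ.- r) ℤ.+ (q ℤ.- s)
    rearrange = ℤ-Solver.solve-∀

  -- Each term times x_{j+1} is the next term times x_j, so only the two ends survive.
  telescope : ∀ s (u t : ℕ → Vec ℕ n) d α →
    (∀ k → k < d → setAt j (suc (at (t k) j)) (t k) ≡ u k) →
    (∀ k → k < d → setAt (suc j) (suc (at (t k) (suc j))) (t k) ≡ u (suc k)) →
    mulDiff (applyUpTo (λ k → s , t k) d) α ≡ s ℤ.* + indicator (u 0) α ℤ.- s ℤ.* + indicator (u d) α
  telescope s u t zero α p q = sym (ℤₚ.+-inverseʳ (s ℤ.* + indicator (u 0) α))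
  telescope s u t (suc d) α p q = begin
    mulDiff (((s , t 0) ∷ []) ++ applyUpTo (λ k → s , t (suc k)) d) α
      ≡⟨ mulDiff-++ ((s , t 0) ∷ []) _ α ⟩
    mulDiff ((s , t 0) ∷ []) α ℤ.+ mulDiff (applyUpTo (λ k → s , t (suc k)) d) α
      ≡⟨ cong₂ ℤ._+_ first (telescope s (u ∘ suc) (t ∘ suc) d α (λ k k<d → p (suc k) (s≤s k<d)) (λ k k<d → q (suc k) (s≤s k<d))) ⟩
    (U 0 ℤ.- U 1) ℤ.+ (U 1 ℤ.- U (suc d)) ≡⟨ cancel (U 0) (U 1) _ ⟩
    U 0 ℤ.- U (suc d) ∎
    where
    U : ℕ → ℤ
    U k = s ℤ.* + indicator (u k) α
    cancel : ∀ p q r → (p ℤ.- q) ℤ.+ (q ℤ.- r) ≡ p ℤ.- r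
    cancel = ℤ-Solver.solve-∀
    single : ∀ {a b} → a ≡ b → coeff ((s , a) ∷ []) α ≡ s ℤ.* + indicator b α
    single {a} refl = trans (coeff-∷ s a [] α) (ℤₚ.+-identityʳ _)
    first : mulDiff ((s , t 0) ∷ []) α ≡ U 0 ℤ.- U 1
    first = cong₂ ℤ._-_ (single (p 0 (s≤s z≤n))) (single (q 0 (s≤s z≤n)))

  mulDiff-block : ∀ s m d a α →
    mulDiff (map (λ k → s , setPair j (m + (d ∸ suc k)) (m + k) a) (upTo d)) α ≡
    s ℤ.* + indicator (setPair j (m + d) m a) α ℤ.- s ℤ.* + indicator (setPair j m (m + d) a) α
  mulDiff-block s m d a α = begin
    _ ≡⟨ cong (λ h → mulDiff h α) (map-upTo _ d) ⟩
    -- In the variables j and j+1, u_k has exponents m+d-k and m+k; `k < d` keeps the truncated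
    -- subtraction exact.
    _ ≡⟨ telescope s (λ k → setPair j (m + (d ∸ k)) (m + k) a) (λ k → setPair j (m + (d ∸ suc k)) (m + k) a) d α
           (λ k k<d → trans (mulVar-setPair j _ _ a j<n)
             (cong (λ e → setPair j e (m + k) a) (trans (sym (+-suc m _)) (cong (_+_ m) (sym (+-∸-assoc 1 k<d))))))
           (λ k k<d → trans (mulVar-suc-setPair j _ _ a j<n) (cong (λ e → setPair j (m + (d ∸ suc k)) e a) (sym (+-suc m k)))) ⟩
    _ ≡⟨ cong₂ (λ p q → s ℤ.* + indicator (setPair j (m + d) p a) α ℤ.- s ℤ.* + indicator (setPair j q (m + d) a) α)
           (+-identityʳ m) (trans (cong (_+_ m) (n∸n≡0 d)) (+-identityʳ m)) ⟩
    _ ∎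

  mulDiff-ddTerm : ∀ c a α → mulDiff (ddTerm j (c , a)) α ≡ c ℤ.* + indicator a α ℤ.- c ℤ.* + indicator (swapAt j a) α
  mulDiff-ddTerm c a α with at a (suc j) ≤? at a j
  ... | yes q≤p rewrite dec-true (at a (suc j) ≤? at a j) q≤p | m≥n⇒m⊓n≡n q≤p | m≤n⇒m∸n≡0 q≤p | +-identityʳ (at a j ∸ at a (suc j)) = begin
    _ ≡⟨ mulDiff-block c (at a (suc j)) (at a j ∸ at a (suc j)) a α ⟩
    _ ≡⟨ cong (λ e → c ℤ.* + indicator (setPair j e (at a (suc j)) a) α ℤ.- c ℤ.* + indicator (setPair j (at a (suc j)) e a) α) (m+[n∸m]≡n q≤p) ⟩
    _ ≡⟨ cong₂ (λ u v → c ℤ.* + indicator u α ℤ.- c ℤ.* + indicator v α) (setPair-at j a) (setPair-swap j a j<n) ⟩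
    _ ∎
  ... | no q≰p rewrite dec-false (at a (suc j) ≤? at a j) q≰p | m≤n⇒m⊓n≡m (≰⇒≥ q≰p) | m≤n⇒m∸n≡0 (≰⇒≥ q≰p) = begin
    _ ≡⟨ mulDiff-block (ℤ.- c) (at a j) (at a (suc j) ∸ at a j) a α ⟩
    _ ≡⟨ cong (λ e → ℤ.- c ℤ.* + indicator (setPair j e (at a j) a) α ℤ.- ℤ.- c ℤ.* + indicator (setPair j (at a j) e a) α) (m+[n∸m]≡n (≰⇒≥ q≰p)) ⟩
    _ ≡⟨ cong₂ (λ u v → ℤ.- c ℤ.* + indicator u α ℤ.- ℤ.- c ℤ.* + indicator v α) (setPair-swap j a j<n) (setPair-at j a) ⟩
    _ ≡⟨ flip c (+ indicator (swapAt j a) α) (+ indicator a α) ⟩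
    _ ∎
    where
    flip : ∀ c x y → ℤ.- c ℤ.* x ℤ.- ℤ.- c ℤ.* y ≡ c ℤ.* y ℤ.- c ℤ.* x
    flip = ℤ-Solver.solve-∀

  -- The defining equation of ∂_j cleared of its denominator; injectivity of multiplication by x_j -
  -- x_{j+1} will replace the division.
  timesDiff-∂ : ∀ f α → timesDiff j (coeff (∂ j f)) α ≡ coeff f α ℤ.- coeff f (swapAt j α)
  timesDiff-∂ f α = trans (sym (mulDiff-timesDiff (∂ j f) α)) (go f)
    where
    rearrange : ∀ p q r s → (p ℤ.- q) ℤ.+ (r ℤ.- s) ≡ (p ℤ.+ r) ℤ.- (q ℤ.+ s)
    rearrange = ℤ-Solver.solve-∀
    go : ∀ f → mulDiff (∂ j f) α ≡ coeff f α ℤ.- coeff f (swapAt j α)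
    go [] = refl
    go ((c , a) ∷ f) = begin
      mulDiff (ddTerm j (c , a) ++ ∂ j f) α ≡⟨ mulDiff-++ (ddTerm j (c , a)) _ α ⟩
      _ ≡⟨ cong₂ ℤ._+_ (mulDiff-ddTerm c a α) (go f) ⟩
      _ ≡⟨ rearrange (c ℤ.* + indicator a α) _ _ _ ⟩
      _ ≡⟨ cong₂ ℤ._-_ (coeff-∷ c a f α) (trans (coeff-∷ c a f (swapAt j α)) (cong (λ m → c ℤ.* + m ℤ.+ coeff f (swapAt j α)) (indicator-swapAt j a α))) ⟨
      _ ∎

  timesDiff-∂̄ : ∀ f α → timesDiff j (coeff (∂̄ j f)) α ≡
    (coeff f α ℤ.- times 0ℤ (suc j) (coeff f) α) ℤ.- (coeff f (swapAt j α) ℤ.- times 0ℤ (suc j) (coeff f) (swapAt j α))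
  timesDiff-∂̄ f α = trans (timesDiff-∂ (f ++ neg (mulVar (suc j) f)) α) (cong₂ ℤ._-_ (expand α) (expand (swapAt j α)))
    where
    expand : ∀ α → coeff (f ++ neg (mulVar (suc j) f)) α ≡ coeff f α ℤ.- times 0ℤ (suc j) (coeff f) α
    expand α = trans (coeff-++ f _ α) (cong (ℤ._+_ (coeff f α)) (trans (coeff-neg (mulVar (suc j) f) α) (cong ℤ.-_ (coeff-mulVar j<n f α))))

-- The coefficient of x^{a+1} y^b in (x - y) f is f_{a,b} - f_{a+1,b-1}, so induction on b recovers
-- f.
timesDiff-injective : ∀ {n} j → suc j < n → (f g : Vec ℕ n → ℤ) → (∀ α → timesDiff j f α ≡ timesDiff j g α) → ∀ α → f α ≡ g α
timesDiff-injective zero _ f g e (a ∷ b ∷ α) = go a b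
  where
  cancel : ∀ p q r → p ℤ.- q ≡ r ℤ.- q → p ≡ r
  cancel p q r = ∙-cancelʳ (ℤ.- q) p r
  go : ∀ a b → f (a ∷ b ∷ α) ≡ g (a ∷ b ∷ α)
  go a zero = cancel _ 0ℤ _ (e (suc a ∷ 0 ∷ α))
  go a (suc b) = cancel _ (f (suc a ∷ b ∷ α)) _ (trans (e (suc a ∷ suc b ∷ α)) (cong (ℤ._-_ (g (a ∷ suc b ∷ α))) (sym (go (suc a) b))))
timesDiff-injective zero (s≤s ()) f g e (a ∷ [])
timesDiff-injective (suc j) (s≤s j<n) f g e (a ∷ α) = timesDiff-injective j j<n (f ∘ (a ∷_)) (g ∘ (a ∷_)) (λ α → e (a ∷ α)) α

-- First ascents

data FirstAscent : ∀ {k} → ℕ → Vec ℕ k → Set where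
  here  : ∀ {k a b} {w : Vec ℕ k} → a < b → FirstAscent 0 (a ∷ b ∷ w)
  there : ∀ {k a b j} {w : Vec ℕ k} → ¬ a < b → FirstAscent j (b ∷ w) → FirstAscent (suc j) (a ∷ b ∷ w)

ascent-<-length : ∀ {k j} {w : Vec ℕ k} → FirstAscent j w → suc j < k
ascent-<-length (here _) = s≤s (s≤s z≤n)
ascent-<-length (there _ p) = s≤s (ascent-<-length p)

-- `firstAscent` with an arbitrary enumeration `f` of positions, so that an induction can pass to
-- the tail of the word.
ascentAmong : ∀ {k} → Vec ℕ k → (ℕ → ℕ) → ℕ → Maybe ℕ
ascentAmong w f m = List.head (filter (λ j → at w j <? at w (suc j)) (applyUpTo f m))

ascentAmong-∷ : ∀ {k} a (w : Vec ℕ k) f m → ascentAmong (a ∷ w) (suc ∘ f) m ≡ Maybe.map suc (ascentAmong w f m)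
ascentAmong-∷ a w f zero = refl
ascentAmong-∷ a w f (suc m) with does (at w (f 0) <? at w (suc (f 0)))
... | true = refl
... | false = ascentAmong-∷ a w (f ∘ suc) m

firstAscent-∷ : ∀ {k a b} (w : Vec ℕ k) → ¬ a < b → firstAscent (a ∷ b ∷ w) ≡ Maybe.map suc (firstAscent (b ∷ w))
firstAscent-∷ {k} {a} {b} w a≮b rewrite <ᵇ-false a≮b = ascentAmong-∷ a (b ∷ w) id k

firstAscent-just : ∀ {k j} {w : Vec ℕ k} → FirstAscent j w → firstAscent w ≡ just j
firstAscent-just (here a<b) rewrite <ᵇ-true a<b = refl
firstAscent-just (there {w = w} a≮b p) = trans (firstAscent-∷ w a≮b) (cong (Maybe.map suc) (firstAscent-just p))

firstAscent-nothing : ∀ {k} {w : Vec ℕ k} → Decreasing w → firstAscent w ≡ nothing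
firstAscent-nothing [] = refl
firstAscent-nothing (_ ∷ []) = refl
firstAscent-nothing {w = a ∷ b ∷ w} ((b<a ∷ _) ∷ q ∷ d) =
  trans (firstAscent-∷ w (<⇒≯ b<a)) (cong (Maybe.map suc) (firstAscent-nothing (q ∷ d)))

decreasing-or-ascent : ∀ {k} {w : Vec ℕ k} → Distinct w → Decreasing w ⊎ ∃ λ j → FirstAscent j w
decreasing-or-ascent [] = inj₁ []
decreasing-or-ascent (_ ∷ []) = inj₁ ([] ∷ [])
decreasing-or-ascent {w = a ∷ b ∷ w} ((a≢b ∷ _) ∷ d) with a <? b | decreasing-or-ascent d
... | yes a<b | _ = inj₂ (0 , here a<b)
... | no a≮b | inj₂ (j , p) = inj₂ (suc j , there a≮b p)
... | no a≮b | inj₁ (q ∷ e) = inj₁ ((b<a ∷ All.map (λ c<b → <-trans c<b b<a) q) ∷ q ∷ e)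
  where b<a = ≤∧≢⇒< (≮⇒≥ a≮b) (≢-sym a≢b)

All-swapAt : ∀ {k} {Q : ℕ → Set} j {w : Vec ℕ k} → All Q w → All Q (swapAt j w)
All-swapAt j [] = []
All-swapAt zero (p ∷ []) = p ∷ []
All-swapAt zero (p ∷ q ∷ ps) = q ∷ p ∷ ps
All-swapAt (suc j) (p ∷ ps) = p ∷ All-swapAt j ps

Distinct-swapAt : ∀ {k} j {w : Vec ℕ k} → Distinct w → Distinct (swapAt j w)
Distinct-swapAt j [] = []
Distinct-swapAt zero (p ∷ []) = p ∷ []
Distinct-swapAt zero ((x≢y ∷ p) ∷ q ∷ d) = (≢-sym x≢y ∷ q) ∷ p ∷ d
Distinct-swapAt (suc j) (p ∷ d) = All-swapAt j p ∷ Distinct-swapAt j d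

greater : ∀ {k} → ℕ → Vec ℕ k → ℕ
greater c [] = 0
greater c (x ∷ w) = (if c <ᵇ x then 1 else 0) + greater c w

coinversions : ∀ {k} → Vec ℕ k → ℕ
coinversions [] = 0
coinversions (x ∷ w) = greater x w + coinversions w

greater-swapAt : ∀ {k} c j (w : Vec ℕ k) → greater c (swapAt j w) ≡ greater c w
greater-swapAt c zero [] = refl
greater-swapAt c zero (x ∷ []) = refl
greater-swapAt c zero (x ∷ y ∷ w) = x∙yz≈y∙xz (if c <ᵇ y then 1 else 0) (if c <ᵇ x then 1 else 0) (greater c w)
greater-swapAt c (suc j) [] = refl
greater-swapAt c (suc j) (x ∷ w) = cong (_+_ (if c <ᵇ x then 1 else 0)) (greater-swapAt c j w)

-- Only the pair at the ascent changes its relative order. Hence coinversions count the steps left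
-- to w₀ and bound the fuel.
coinversions-swapAt : ∀ {k j} {w : Vec ℕ k} → FirstAscent j w → coinversions w ≡ suc (coinversions (swapAt j w))
coinversions-swapAt {w = a ∷ b ∷ w} (here a<b) rewrite <ᵇ-true a<b | <ᵇ-false (<⇒≯ a<b) =
  rearrange (greater a w) (greater b w) _
  where
  rearrange : ∀ p q r → (1 + p) + (q + r) ≡ suc (q + (p + r))
  rearrange = solve-∀
coinversions-swapAt {j = suc j} {w = a ∷ w} (there _ p) =
  trans (cong₂ _+_ (sym (greater-swapAt a j w)) (coinversions-swapAt p)) (+-suc _ _)

greater-≤ : ∀ {k} c (w : Vec ℕ k) → greater c w ≤ k
greater-≤ c [] = z≤n
greater-≤ c (x ∷ w) with c <ᵇ x
... | true = s≤s (greater-≤ c w)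
... | false = m≤n⇒m≤1+n (greater-≤ c w)

coinversions-≤ : ∀ {k} (w : Vec ℕ k) → coinversions w ≤ k * k
coinversions-≤ [] = z≤n
coinversions-≤ {suc k} (x ∷ w) = m≤n⇒m≤1+n (+-mono-≤ (greater-≤ x w) (≤-trans (coinversions-≤ w) (*-monoʳ-≤ k (n≤1+n k))))

-- The unsigned polynomials at an ascent

T-ascent : ∀ {k j} {w : Vec ℕ k} f → FirstAscent j w → T j f w ≡ 0
T-ascent f (here a<b) rewrite <ᵇ-false (<⇒≯ a<b) = refl
T-ascent f (there _ p) = T-ascent (f ∘ (_ ∷_)) p

T-descent : ∀ {k j} {w : Vec ℕ k} f → FirstAscent j w → T j f (swapAt j w) ≡ f (swapAt j w) + f w
T-descent f (here a<b) rewrite <ᵇ-true a<b = refl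
T-descent f (there _ p) = T-descent (f ∘ (_ ∷_)) p

times-swapAt : ∀ {n} j → suc j < n → (f : Vec ℕ n → ℕ) → ∀ α → times 0 (suc j) f (swapAt j α) ≡ times 0 j (λ α → f (swapAt j α)) α
times-swapAt zero _ f (a ∷ b ∷ α) = refl
times-swapAt zero (s≤s ()) f (a ∷ [])
times-swapAt (suc j) (s≤s j<n) f (a ∷ α) = times-swapAt j j<n (f ∘ (a ∷_)) α

-- T_j produces no word with an ascent at `j`, so at such a word the symmetric product P (1 +
-- x_{j+1} T_j) reduces to P.
P-ascent-symmetric : ∀ {k n j} {w : Vec ℕ k} → FirstAscent j w → (α : Vec ℕ n) → P k w α ≡ P k w (swapAt j α)
P-ascent-symmetric {k} {j = j} {w} p α = begin
  P k w α ≡⟨ sym (trans (cong (_+_ (P k w α)) (T-ascent _ p)) (+-identityʳ _)) ⟩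
  times-T j j (P k) w α ≡⟨ P-symmetric k j w α ⟩
  times-T j j (P k) w (swapAt j α) ≡⟨ trans (cong (_+_ (P k w (swapAt j α))) (T-ascent _ p)) (+-identityʳ _) ⟩
  P k w (swapAt j α) ∎

-- With f = P (w s_j) and g = P w: the polynomial (1 + x_{j+1}) f + x_{j+1} g is symmetric.
ascentSum : ∀ {n} → ℕ → (f g : Vec ℕ n → ℕ) → Vec ℕ n → ℕ
ascentSum j f g α = f α + (times 0 (suc j) f α + times 0 (suc j) g α)

-- At w s_j, which has a descent at `j`, T_j collects from both w s_j and w; these are the two
-- summands carrying x_{j+1}.
P-ascent-relation : ∀ {k n j} {w : Vec ℕ k} → FirstAscent j w → (α : Vec ℕ n) →
  ascentSum j (P k (swapAt j w)) (P k w) α ≡ ascentSum j (P k (swapAt j w)) (P k w) (swapAt j α)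
P-ascent-relation {k} {j = j} {w} p α = trans (sym (to α)) (trans (P-symmetric k j (swapAt j w) α) (to (swapAt j α)))
  where
  to : ∀ α → times-T j j (P k) (swapAt j w) α ≡ ascentSum j (P k (swapAt j w)) (P k w) α
  to α = cong (_+_ (P k (swapAt j w) α)) (T-descent _ p)

-- Comparison of 𝔊 with P, and the upper bound

sign : ℕ → ℤ
sign zero = 1ℤ
sign (suc k) = ℤ.- sign k

sign-double : ∀ k → sign (k + k) ≡ 1ℤ
sign-double zero = refl
sign-double (suc k) rewrite +-suc k k = trans (ℤₚ.neg-involutive _) (sign-double k)

sign-*≡0 : ∀ k m → sign k ℤ.* + m ≡ 0ℤ → m ≡ 0
sign-*≡0 zero m e = ℤₚ.+-injective (trans (sym (ℤₚ.*-identityˡ (+ m))) e)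
sign-*≡0 (suc k) m e = sign-*≡0 k m (ℤₚ.neg-injective (trans (ℤₚ.neg-distribˡ-* (sign k) (+ m)) e))

-- The coefficient function of (-1)^e f(-x).
twist : ∀ {n} → ℕ → (Vec ℕ n → ℕ) → Vec ℕ n → ℤ
twist e f α = sign (e + ∣ α ∣ₑ) ℤ.* + f α

times-twist : ∀ {n} i e (f : Vec ℕ n → ℕ) α → times 0ℤ i (twist (suc e) f) α ≡ twist e (times 0 i f) α
times-twist i e f [] = sym (ℤₚ.*-zeroʳ (sign (e + 0)))
times-twist zero e f (zero ∷ α) = sym (ℤₚ.*-zeroʳ (sign (e + ∣ α ∣ₑ)))
times-twist zero e f (suc a ∷ α) = cong (λ k → sign k ℤ.* + f (a ∷ α)) (sym (+-suc e (a + ∣ α ∣ₑ)))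
times-twist (suc i) e f (a ∷ α) = begin
  times 0ℤ i (λ α → twist (suc e) f (a ∷ α)) α
    ≡⟨ times-cong i (λ α → cong (λ k → sign (suc k) ℤ.* + f (a ∷ α)) (sym (+-assoc e a ∣ α ∣ₑ))) α ⟩
  times 0ℤ i (twist (suc (e + a)) (f ∘ (a ∷_))) α
    ≡⟨ times-twist i (e + a) (f ∘ (a ∷_)) α ⟩
  twist (e + a) (times 0 i (f ∘ (a ∷_))) α
    ≡⟨ cong (λ k → sign k ℤ.* + times 0 i (f ∘ (a ∷_)) α) (+-assoc e a ∣ α ∣ₑ) ⟩
  twist e (times 0 (suc i) f) (a ∷ α) ∎

times-twist′ : ∀ {n} i e (f : Vec ℕ n → ℕ) α → times 0ℤ i (twist e f) α ≡ twist (suc e) (times 0 i f) α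
times-twist′ i e f α = trans
  (times-cong i (λ α → cong (ℤ._* + f α) (sym (ℤₚ.neg-involutive (sign (e + ∣ α ∣ₑ))))) α)
  (times-twist i (suc e) f α)

size-swapAt : ∀ {n} j (α : Vec ℕ n) → ∣ swapAt j α ∣ₑ ≡ ∣ α ∣ₑ
size-swapAt zero [] = refl
size-swapAt zero (a ∷ []) = refl
size-swapAt zero (a ∷ b ∷ α) = x∙yz≈y∙xz b a ∣ α ∣ₑ
size-swapAt (suc j) [] = refl
size-swapAt (suc j) (a ∷ α) = cong (_+_ a) (size-swapAt j α)

-- As g is symmetric, the relation says (x_j - x_{j+1}) g = (1 + x_{j+1}) f - s_j((1 + x_{j+1}) f),
-- that is, g = ∂_j((1 + x_{j+1}) f). Replacing x by -x gives the factor 1 - x_{j+1}, and the sign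
-- of the denominator turns `e` into `suc e`.
coeff-∂̄-twist : ∀ {n} j → suc j < n → ∀ e (F : Poly n) (f g : Vec ℕ n → ℕ) →
  (∀ α → g α ≡ g (swapAt j α)) → (∀ α → ascentSum j f g α ≡ ascentSum j f g (swapAt j α)) →
  (∀ α → coeff F α ≡ twist e f α) → ∀ α → coeff (∂̄ j F) α ≡ twist (suc e) g α
coeff-∂̄-twist j j<n e F f g g-sym rel F≡f = timesDiff-injective j j<n _ _ λ α → begin
  timesDiff j (coeff (∂̄ j F)) α
    ≡⟨ timesDiff-∂̄ j j<n F α ⟩
  (coeff F α ℤ.- times 0ℤ (suc j) (coeff F) α) ℤ.- (coeff F (swapAt j α) ℤ.- times 0ℤ (suc j) (coeff F) (swapAt j α))
    ≡⟨ cong₂ ℤ._-_ (half α) (trans (half (swapAt j α)) (cong (λ s → sign (e + s) ℤ.* + f (swapAt j α) ℤ.- sign (suc e + s) ℤ.* + Y f (swapAt j α)) (size-swapAt j α))) ⟩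
  (S α ℤ.* + f α ℤ.- ℤ.- S α ℤ.* + Y f α) ℤ.- (S α ℤ.* + f (swapAt j α) ℤ.- ℤ.- S α ℤ.* + Y f (swapAt j α))
    -- The terms in g are added and subtracted to complete the bracket, which vanishes by the
    -- relation.
    ≡⟨ collect (S α) _ _ _ _ (+ Y g α) (+ times 0 j g α) ⟩
  S α ℤ.* + times 0 j g α ℤ.- S α ℤ.* + Y g α
    ℤ.+ S α ℤ.* ((+ f α ℤ.+ (+ Y f α ℤ.+ + Y g α)) ℤ.- (+ f (swapAt j α) ℤ.+ (+ Y f (swapAt j α) ℤ.+ + times 0 j g α)))
    ≡⟨ cong (λ z → S α ℤ.* + times 0 j g α ℤ.- S α ℤ.* + Y g α ℤ.+ S α ℤ.* z)
         (ℤₚ.i≡j⇒i-j≡0 (relℤ α)) ⟩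
  S α ℤ.* + times 0 j g α ℤ.- S α ℤ.* + Y g α ℤ.+ S α ℤ.* 0ℤ
    ≡⟨ trans (cong (ℤ._+_ (S α ℤ.* + times 0 j g α ℤ.- S α ℤ.* + Y g α)) (ℤₚ.*-zeroʳ (S α))) (ℤₚ.+-identityʳ _) ⟩
  S α ℤ.* + times 0 j g α ℤ.- S α ℤ.* + Y g α
    ≡⟨ cong₂ ℤ._-_ (times-twist j e g α) (times-twist (suc j) e g α) ⟨
  timesDiff j (twist (suc e) g) α ∎
  where
  S = λ α → sign (e + ∣ α ∣ₑ)
  Y = times 0 (suc j)
  half : ∀ α → coeff F α ℤ.- times 0ℤ (suc j) (coeff F) α ≡ S α ℤ.* + f α ℤ.- ℤ.- S α ℤ.* + Y f α
  half α = cong₂ ℤ._-_ (F≡f α) (trans (times-cong (suc j) F≡f α) (times-twist′ (suc j) e f α))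
  collect : ∀ S a b a′ b′ y x → (S ℤ.* a ℤ.- ℤ.- S ℤ.* b) ℤ.- (S ℤ.* a′ ℤ.- ℤ.- S ℤ.* b′) ≡
    S ℤ.* x ℤ.- S ℤ.* y ℤ.+ S ℤ.* ((a ℤ.+ (b ℤ.+ y)) ℤ.- (a′ ℤ.+ (b′ ℤ.+ x)))
  collect = ℤ-Solver.solve-∀
  relℤ : ∀ α → + f α ℤ.+ (+ Y f α ℤ.+ + Y g α) ≡ + f (swapAt j α) ℤ.+ (+ Y f (swapAt j α) ℤ.+ + times 0 j g α)
  relℤ α = cong +_ (trans (rel α) (cong (λ m → f (swapAt j α) + (Y f (swapAt j α) + m))
    (trans (times-swapAt j j<n g α) (times-cong j (λ α → sym (g-sym α)) α))))

staircase-tabulate : ∀ k n → tabulate {n = n} (λ i → k ∸ suc (toℕ i)) ≡ staircase k n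
staircase-tabulate k zero = refl
staircase-tabulate k (suc n) = cong (k ∸ 1 ∷_) (trans (tabulate-cong (λ i → sym (∸-+-assoc k 1 (suc (toℕ i))))) (staircase-tabulate (k ∸ 1) n))

coeff-topPoly : ∀ {n} (α : Vec ℕ n) → coeff topPoly α ≡ twist ∣ staircase n n ∣ₑ (indicator (staircase n n)) α
coeff-topPoly {n} α = begin
  coeff topPoly α ≡⟨ cong (λ v → coeff ((1ℤ , v) ∷ []) α) (staircase-tabulate n n) ⟩
  coeff ((1ℤ , staircase n n) ∷ []) α ≡⟨ coeff-∷ 1ℤ (staircase n n) [] α ⟩
  1ℤ ℤ.* + indicator (staircase n n) α ℤ.+ 0ℤ ≡⟨ ℤₚ.+-identityʳ _ ⟩
  1ℤ ℤ.* + indicator (staircase n n) α ≡⟨ sign-irrelevant ⟩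
  twist ∣ staircase n n ∣ₑ (indicator (staircase n n)) α ∎
  where
  sign-irrelevant : 1ℤ ℤ.* + indicator (staircase n n) α ≡ twist ∣ staircase n n ∣ₑ (indicator (staircase n n)) α
  sign-irrelevant with ≡-dec _≟_ (staircase n n) α
  ... | yes refl = cong (ℤ._* + indicator (staircase n n) (staircase n n)) (sym (sign-double ∣ staircase n n ∣ₑ))
  ... | no s≢α rewrite indicator-≢ _ _ s≢α = sym (ℤₚ.*-zeroʳ (sign (∣ staircase n n ∣ₑ + ∣ α ∣ₑ)))

nonrecords : ∀ {k} → ℕ → Vec ℕ k → ℕ
nonrecords c [] = 0
nonrecords c (x ∷ w) = if c <ᵇ x then nonrecords x w else suc (nonrecords c w)

-- The i-th entry counts the later entries of w that are not left-to-right
-- maxima of w_i w_{i+1} ⋯; padded with zeros to length n.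
maxExponent : ∀ {k} → Vec ℕ k → ∀ n → Vec ℕ n
maxExponent w zero = []
maxExponent [] (suc n) = 0 ∷ maxExponent [] n
maxExponent (x ∷ w) (suc n) = nonrecords x w ∷ maxExponent w n

-- Only entry `j` is compared, and entry `j` + 1 is left free: it is bounded by treating s_j α in
-- the same way.
data Raised : ∀ {n} → ℕ → Vec ℕ n → Vec ℕ n → Set where
  here  : ∀ {n a b a′ b′} {α : Vec ℕ n} → a < a′ → Raised 0 (a ∷ b ∷ α) (a′ ∷ b′ ∷ α)
  there : ∀ {n j a} {α β : Vec ℕ n} → Raised j α β → Raised (suc j) (a ∷ α) (a ∷ β)

-- Compare the relation at (a+1, b) with its swap, which contains g_{b,a} = g_{a,b} ≠ 0. Natural
-- numbers do not cancel, so one of f_{a+1,b}, f_{a+1,b-1}, g_{a+1,b-1} is nonzero; in the last case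
-- recurse on b.
raise : ∀ {n} j → suc j < n → (f g : Vec ℕ n → ℕ) → (∀ α → g α ≡ g (swapAt j α)) →
  (∀ α → ascentSum j f g α ≡ ascentSum j f g (swapAt j α)) →
  ∀ α → g α ≢ 0 → Σ (Vec ℕ n) λ β → f β ≢ 0 × Raised j α β
raise zero (s≤s ()) f g g-sym rel (a ∷ [])
raise zero _ f g g-sym rel (a ∷ b ∷ α) = go a b
  where
  go : ∀ a b → g (a ∷ b ∷ α) ≢ 0 → Σ _ λ β → f β ≢ 0 × Raised 0 (a ∷ b ∷ α) β
  go a b g≢0 with f (suc a ∷ b ∷ α) ≟ 0
  ... | no f≢0 = _ , f≢0 , here ≤-refl
  go a zero g≢0 | yes f≡0 = contradiction (trans (g-sym _) (m+n≡0⇒n≡0 (f (0 ∷ a ∷ α))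
    (m+n≡0⇒n≡0 (f (0 ∷ suc a ∷ α)) (trans (sym (rel (suc a ∷ 0 ∷ α))) (trans (+-identityʳ _) f≡0))))) g≢0
  go a (suc b) g≢0 | yes f≡0 with f (suc a ∷ b ∷ α) ≟ 0 | g (suc a ∷ b ∷ α) ≟ 0
  ... | no f≢0 | _ = _ , f≢0 , here ≤-refl
  ... | yes _ | no g′≢0 with go (suc a) b g′≢0
  ... | _ , f≢0 , here a<a′ = _ , f≢0 , here (<⇒≤ a<a′)
  go a (suc b) g≢0 | yes f≡0 | yes f′≡0 | yes g′≡0 = contradiction
    (trans (g-sym _) (m+n≡0⇒n≡0 (f (suc b ∷ a ∷ α)) (m+n≡0⇒n≡0 (f (suc b ∷ suc a ∷ α))
      (trans (sym (rel (suc a ∷ suc b ∷ α))) (cong₂ _+_ f≡0 (cong₂ _+_ f′≡0 g′≡0)))))) g≢0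
raise (suc j) (s≤s j<n) f g g-sym rel (a ∷ α) g≢0
  with raise j j<n (f ∘ (a ∷_)) (g ∘ (a ∷_)) (λ α → g-sym (a ∷ α)) (λ α → rel (a ∷ α)) α g≢0
... | β , f≢0 , r = a ∷ β , f≢0 , there r

-- The entries weakly decrease from `x` down to the ascent p < q. So p is no record in either order,
-- and whether q is one depends on `x` alone.
nonrecords-swapAt : ∀ {k j y} {w : Vec ℕ k} x → FirstAscent j (y ∷ w) → ¬ x < y →
  nonrecords x (swapAt j (y ∷ w)) ≡ nonrecords x (y ∷ w)
nonrecords-swapAt {w = q ∷ w} x (here {a = p} p<q) x≮p with x <? q
... | yes x<q rewrite <ᵇ-true x<q | <ᵇ-false x≮p | <ᵇ-false (<⇒≯ p<q) = refl
... | no x≮q rewrite <ᵇ-false x≮q | <ᵇ-false x≮p = refl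
nonrecords-swapAt {w = z ∷ w} x (there {a = y} y≮z p) x≮y rewrite <ᵇ-false x≮y =
  cong suc (nonrecords-swapAt x p (≤⇒≯ (≤-trans (≮⇒≥ y≮z) (≮⇒≥ x≮y))))

-- At the ascent p < q both entries of the bound for w equal N = `nonrecords q`, taken over the
-- letters after q, while entry `j` of the bound for w s_j is N + 1. So strict inequalities below N
-- + 1 suffice at both places.
≤-maxExponent : ∀ {k n j} {w : Vec ℕ k} {α β β′ : Vec ℕ n} → FirstAscent j w →
  Raised j α β → Raised j (swapAt j α) β′ →
  β ≤ᶜ maxExponent (swapAt j w) n → β′ ≤ᶜ maxExponent (swapAt j w) n → α ≤ᶜ maxExponent w n
≤-maxExponent (here p<q) (here a<a′) (here b<b″) (a′≤ ∷ _ ∷ α≤) (b″≤ ∷ _)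
  rewrite <ᵇ-true p<q | <ᵇ-false (<⇒≯ p<q) =
  ≤-pred (≤-trans a<a′ a′≤) ∷ ≤-pred (≤-trans b<b″ b″≤) ∷ α≤
≤-maxExponent (there {a = x} x≮y p) (there r) (there r′) (a≤ ∷ β≤) (_ ∷ β′≤) =
  subst (_ ≤_) (nonrecords-swapAt x p x≮y) a≤ ∷ ≤-maxExponent p r r′ β≤ β′≤

maxExponent-decreasing : ∀ {k} n {w : Vec ℕ k} → Decreasing w → maxExponent w n ≡ staircase k n
maxExponent-decreasing zero d = refl
maxExponent-decreasing (suc n) [] = cong (0 ∷_) (maxExponent-decreasing n [])
maxExponent-decreasing (suc n) (p ∷ d) = cong₂ _∷_ (count p) (maxExponent-decreasing n d)
  where
  count : ∀ {k x} {w : Vec ℕ k} → All (x >_) w → nonrecords x w ≡ k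
  count [] = refl
  count (y<x ∷ p) rewrite <ᵇ-false (<⇒≯ y<x) = cong suc (count p)

P-bound-decreasing : ∀ {n} {w α : Vec ℕ n} → Decreasing w → P n w α ≢ 0 → α ≤ᶜ maxExponent w n
P-bound-decreasing {n} {w} {α} d P≢0 with ≡-dec _≟_ (staircase n n) α
... | yes refl rewrite maxExponent-decreasing n d = Pointwise.refl ≤-refl
... | no s≢α = contradiction (trans (P-decreasing n w α ≤-refl d) (indicator-≢ _ _ s≢α)) P≢0

-- Both claims follow the same recursion from w s_j to w. The number `e` starts as the length of w₀
-- and grows as the length drops, so it has the parity of ℓ(w).
groth-P : ∀ fuel {n} (w : Vec ℕ n) → Distinct w → coinversions w ≤ fuel →
  (Σ ℕ λ e → ∀ α → coeff (grothF fuel w) α ≡ twist e (P n w) α) × (∀ α → P n w α ≢ 0 → α ≤ᶜ maxExponent w n)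
groth-P fuel {n} w d c≤ with decreasing-or-ascent d
... | inj₁ dec = (∣ staircase n n ∣ₑ , λ α → trans (cong (λ f → coeff f α) (top fuel)) (trans (coeff-topPoly α)
        (cong (λ m → sign (∣ staircase n n ∣ₑ + ∣ α ∣ₑ) ℤ.* + m) (sym (P-decreasing n w α ≤-refl dec))))) , λ α → P-bound-decreasing dec
  where
  top : ∀ fuel → grothF fuel w ≡ topPoly
  top zero = refl
  top (suc fuel) rewrite firstAscent-nothing dec = refl
... | inj₂ (j , p) with fuel
... | zero = contradiction (≤-trans (≤-reflexive (sym (coinversions-swapAt p))) c≤) λ ()
... | suc fuel rewrite firstAscent-just p
  with groth-P fuel (swapAt j w) (Distinct-swapAt j d) (≤-pred (≤-trans (≤-reflexive (sym (coinversions-swapAt p))) c≤))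
... | (e , coeff≡) , bound = (suc e , coeff-∂̄-twist j j<n e (grothF fuel (swapAt j w)) (P n (swapAt j w)) (P n w) (P-ascent-symmetric p) (P-ascent-relation p) coeff≡) , bound′
  where
  j<n = ascent-<-length p
  raise-P : ∀ α → P n w α ≢ 0 → Σ (Vec ℕ n) λ β → P n (swapAt j w) β ≢ 0 × Raised j α β
  raise-P = raise j j<n (P n (swapAt j w)) (P n w) (P-ascent-symmetric p) (P-ascent-relation p)
  bound′ : ∀ α → P n w α ≢ 0 → α ≤ᶜ maxExponent w n
  -- By symmetry s_j α is in the support too; raising its entry `j` bounds entry `j` + 1 of α.
  bound′ α P≢0 with raise-P α P≢0 | raise-P (swapAt j α) (P≢0 ∘ trans (P-ascent-symmetric p α))
  ... | β , Pβ≢0 , r | β′ , Pβ′≢0 , r′ = ≤-maxExponent p r r′ (bound β Pβ≢0) (bound β′ Pβ′≢0)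

-- Fireworks permutations

-- Each further column factor 1 + x_i T_i is left unused, or acts trivially at a descent, or creates a descent.
data Path : ∀ {k n} → Vec ℕ k → Vec ℕ n → Vec ℕ k → Vec ℕ n → Set where
  []   : ∀ {n} {α : Vec ℕ n} → Path [] α [] α
  skip : ∀ {k n x a} {v v′ : Vec ℕ k} {α α′ : Vec ℕ n} →
    Path v α v′ α′ → Path (x ∷ v) (a ∷ α) (x ∷ v′) (a ∷ α′)
  stay : ∀ {k n x y a} {v : Vec ℕ k} {v′ : Vec ℕ (suc k)} {α α′ : Vec ℕ n} →
    y < x → Path (y ∷ v) α v′ α′ → Path (x ∷ y ∷ v) (a ∷ α) (x ∷ v′) (suc a ∷ α′)
  swap : ∀ {k n x y a} {v : Vec ℕ k} {v′ : Vec ℕ (suc k)} {α α′ : Vec ℕ n} →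
    x < y → Path (x ∷ v) α v′ α′ → Path (x ∷ y ∷ v) (a ∷ α) (y ∷ v′) (suc a ∷ α′)

-- All summands are natural numbers, so a single path with a positive start suffices.
Col-positive : ∀ {k n} (F : Family k n) {v α v′ α′} → Path v α v′ α′ → 0 < F v α → 0 < Col F v′ α′
Col-positive F [] F>0 = F>0
Col-positive F (skip {x = x} {a} p) F>0 = Col-positive (H F x a) p (m≤n⇒m≤n+o _ F>0)
Col-positive F (stay {x = x} {y} {a} {v} {α = α} y<x p) F>0 = Col-positive (H F x (suc a)) p H>0
  where
  H>0 : 0 < H F x (suc a) (y ∷ v) α
  H>0 rewrite <ᵇ-true y<x = m≤n⇒m≤o+n (F (x ∷ y ∷ v) (suc a ∷ α)) (m≤n⇒m≤n+o _ F>0)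
Col-positive F (swap {x = x} {y} {a} {v} {α = α} x<y p) F>0 = Col-positive (H F y (suc a)) p H>0
  where
  H>0 : 0 < H F y (suc a) (x ∷ v) α
  H>0 rewrite <ᵇ-true x<y = m≤n⇒m≤o+n (F (y ∷ x ∷ v) (suc a ∷ α)) (m≤n⇒m≤o+n (F (y ∷ x ∷ v) (a ∷ α)) F>0)

data Insert (z : ℕ) : ∀ {k} → Vec ℕ k → Vec ℕ (suc k) → Set where
  here  : ∀ {k} {u : Vec ℕ k} → Insert z u (z ∷ u)
  there : ∀ {k x} {u : Vec ℕ k} {w} → Insert z u w → Insert z (x ∷ u) (x ∷ w)

All-insert : ∀ {k z} {Q : ℕ → Set} {u : Vec ℕ k} {w} → Insert z u w → Q z → All Q u → All Q w
All-insert here q qs = q ∷ qs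
All-insert (there i) q (q′ ∷ qs) = q′ ∷ All-insert i q qs

All-uninsert : ∀ {k z} {Q : ℕ → Set} {u : Vec ℕ k} {w} → Insert z u w → All Q w → Q z × All Q u
All-uninsert here (q ∷ qs) = q , qs
All-uninsert (there i) (q′ ∷ qs) with All-uninsert i qs
... | q , qs′ = q , q′ ∷ qs′

Distinct-uninsert : ∀ {k z} {u : Vec ℕ k} {w} → Insert z u w → Distinct w → Distinct u
Distinct-uninsert here (_ ∷ d) = d
Distinct-uninsert (there i) (p ∷ d) = proj₂ (All-uninsert i p) ∷ Distinct-uninsert i d

extract-min : ∀ {k} (w : Vec ℕ (suc k)) → Distinct w → ∃ λ z → ∃ λ u → Insert z u w × All (z <_) u
extract-min (x ∷ []) d = x , [] , here , []
extract-min (x ∷ y ∷ w) (p ∷ d) with extract-min (y ∷ w) d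
... | z , u , i , z<u with <-cmp x z
... | tri< x<z _ _ = x , y ∷ w , here , All-insert i x<z (All.map (<-trans x<z) z<u)
... | tri≈ _ x≡z _ = contradiction x≡z (proj₁ (All-uninsert i p))
... | tri> _ _ z<x = z , x ∷ u , there i , z<x ∷ z<u

-- Tail m p w: w may follow the entry p in a fireworks word whose run of p has leader m.
data Tail (m p : ℕ) : ∀ {k} → Vec ℕ k → Set where
  []   : Tail m p []
  down : ∀ {k y} {w : Vec ℕ k} → y < p → Tail m y w → Tail m p (y ∷ w)
  up   : ∀ {k y} {w : Vec ℕ k} → m < y → Tail y y w → Tail m p (y ∷ w)

data FireworksWord : ∀ {k} → Vec ℕ k → Set where
  []  : FireworksWord []
  _∷_ : ∀ {k} x {w : Vec ℕ k} → Tail x x w → FireworksWord (x ∷ w)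

-- A suffix may begin in the middle of a run, so the leader `m` of that run is kept as hidden data.
data FireworksSuffix : ∀ {k} → Vec ℕ k → Set where
  suffix : ∀ {k m x} {w : Vec ℕ k} → x ≤ m → Tail m x w → FireworksSuffix (x ∷ w)

Linked⇒Tail : ∀ {k} m p (w : Vec ℕ k) → Distinct (p ∷ w) → Linked _<_ (m ∷ leadersFrom p (toList w)) → Tail m p w
Linked⇒Tail m p [] d l = []
Linked⇒Tail m p (y ∷ w) ((p≢y ∷ _) ∷ d) l with p <? y
... | no p≮y rewrite <ᵇ-false p≮y = down (≤∧≢⇒< (≮⇒≥ p≮y) (≢-sym p≢y)) (Linked⇒Tail m y w d l)
... | yes p<y rewrite <ᵇ-true p<y with l
... | m<y ∷ l′ = up m<y (Linked⇒Tail y y w d l′)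

Fireworks⇒FireworksWord : ∀ {k} (w : Vec ℕ k) → Distinct w → Fireworks w → FireworksWord w
Fireworks⇒FireworksWord [] d l = []
Fireworks⇒FireworksWord (x ∷ w) d l = x ∷ Linked⇒Tail x x w d l

-- The smallest letter ends its run, and `z < p` with `p ≤ m` keeps it from being a leader. So what
-- follows it is a new run, whose leader already exceeds `m`.
Tail-uninsert : ∀ {k m p z} {u : Vec ℕ k} {w} → Insert z u w → z < p → p ≤ m → All (z <_) u → Tail m p w → Tail m p u
Tail-uninsert here z<p p≤m z<u (up m<z _) = contradiction (<-trans z<p (≤-<-trans p≤m m<z)) (<-irrefl refl)
Tail-uninsert here z<p p≤m z<u (down _ []) = []
Tail-uninsert here z<p p≤m (z<y ∷ _) (down _ (down y<z _)) = contradiction y<z (<⇒≯ z<y)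
Tail-uninsert here z<p p≤m z<u (down _ (up m<y t)) = up m<y t
Tail-uninsert (there i) z<p p≤m (z<x ∷ z<u) (down x<p t) = down x<p (Tail-uninsert i z<x (<⇒≤ (<-≤-trans x<p p≤m)) z<u t)
Tail-uninsert (there i) z<p p≤m (z<x ∷ z<u) (up m<x t) = up m<x (Tail-uninsert i z<x ≤-refl z<u t)

FireworksWord-uninsert : ∀ {k z} {u : Vec ℕ k} {w} → Insert z u w → All (z <_) u → FireworksWord w → FireworksWord u
FireworksWord-uninsert here z<u (_ ∷ []) = []
FireworksWord-uninsert here (z<y ∷ _) (_ ∷ down y<z _) = contradiction y<z (<⇒≯ z<y)
FireworksWord-uninsert here z<u (_ ∷ up _ t) = _ ∷ t
FireworksWord-uninsert (there i) (z<x ∷ z<u) (x ∷ t) = x ∷ Tail-uninsert i z<x ≤-refl z<u t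

-- Both thresholds dominate the rest of the run and lie below the next leader, after which the
-- counts coincide.
nonrecords-Tail : ∀ {k m p c d} {w : Vec ℕ k} → Tail m p w → p ≤ c → c ≤ m → p ≤ d → d ≤ m → nonrecords c w ≡ nonrecords d w
nonrecords-Tail [] _ _ _ _ = refl
nonrecords-Tail (down y<p t) p≤c c≤m p≤d d≤m
  rewrite <ᵇ-false (<⇒≯ (<-≤-trans y<p p≤c)) | <ᵇ-false (<⇒≯ (<-≤-trans y<p p≤d)) =
  cong suc (nonrecords-Tail t (≤-trans (<⇒≤ y<p) p≤c) c≤m (≤-trans (<⇒≤ y<p) p≤d) d≤m)
nonrecords-Tail (up m<y t) p≤c c≤m p≤d d≤m rewrite <ᵇ-true (≤-<-trans c≤m m<y) | <ᵇ-true (≤-<-trans d≤m m<y) = refl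

-- The initial exponents belong to `w`, one position further on. At a descent the counts for
-- neighbouring letters differ by one, which is the factor used; at an ascent they agree and the
-- factor is skipped.
stay-path : ∀ {k n m x} {w : Vec ℕ k} → k < n → x ≤ m → Tail m x w →
  Path (x ∷ w) (maxExponent w n) (x ∷ w) (maxExponent (x ∷ w) n)
stay-path {n = suc n} _ x≤m [] = skip []
stay-path {n = suc n} {x = x} (s≤s k<n) x≤m (down {y = y} y<x t)
  rewrite <ᵇ-false (<⇒≯ y<x) | nonrecords-Tail t (<⇒≤ y<x) x≤m ≤-refl (<⇒≤ (<-≤-trans y<x x≤m)) =
  stay y<x (stay-path k<n (<⇒≤ (<-≤-trans y<x x≤m)) t)
stay-path {n = suc n} (s≤s k<n) x≤m (up m<y t) rewrite <ᵇ-true (≤-<-trans x≤m m<y) = skip (stay-path k<n ≤-refl t)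

nonrecords-insert : ∀ {k x z} {u : Vec ℕ k} {w} → Insert z u w → z < x → All (z <_) u → nonrecords x w ≡ suc (nonrecords x u)
nonrecords-insert here z<x z<u rewrite <ᵇ-false (<⇒≯ z<x) = refl
nonrecords-insert {x = x} (there {x = y} i) z<x (z<y ∷ z<u) with x <ᵇ y
... | true = nonrecords-insert i z<y z<u
... | false = cong suc (nonrecords-insert i z<x z<u)

-- Every letter before `z` gains exactly one nonrecord, namely `z`, which matches the exponent
-- gained by the swap past it. Once `z` is in place, `stay-path` takes over.
insertion-path : ∀ {k n z} {u : Vec ℕ k} {w} → Insert z u w → All (z <_) u → FireworksSuffix w → k < n →
  Path (z ∷ u) (maxExponent u n) w (maxExponent w n)
insertion-path here z<u (suffix z≤m t) k<n = stay-path k<n z≤m t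
insertion-path {n = suc n} (there {x = x} i) (z<x ∷ z<u) (suffix x≤m t) (s≤s k<n)
  rewrite nonrecords-insert i z<x z<u = swap z<x (insertion-path i z<u (next t) k<n)
  where
  next : ∀ {k} {w : Vec ℕ (suc k)} → Tail _ x w → FireworksSuffix w
  next (down y<x t) = suffix (<⇒≤ (<-≤-trans y<x x≤m)) t
  next (up _ t) = suffix ≤-refl t

-- Induction by removing the smallest letter. Arbitrary distinct letters are allowed, so the
-- remaining word need not be standardized.
P-maxExponent-positive : ∀ {k n} (w : Vec ℕ k) → k ≤ n → Distinct w → FireworksWord w → 0 < P k w (maxExponent w n)
P-maxExponent-positive {n = n} [] _ _ _ = ≤-reflexive (sym (trans (cong (indicator (replicate n 0)) (maxExponent-[] n)) (indicator-refl (replicate n 0))))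
  where
  maxExponent-[] : ∀ n → maxExponent [] n ≡ replicate n 0
  maxExponent-[] zero = refl
  maxExponent-[] (suc n) = cong (0 ∷_) (maxExponent-[] n)
P-maxExponent-positive {suc k} {n} w@(_ ∷ _) k<n d f@(_ ∷ t) with extract-min w d
... | z , u , i , z<u = Col-positive (ι (P k)) (insertion-path i z<u (suffix ≤-refl t) k<n) ι>0
  where
  below-All : ∀ {k} {u : Vec ℕ k} → All (z <_) u → below z u ≡ true
  below-All [] = refl
  below-All (z<x ∷ z<u) rewrite <ᵇ-true z<x = below-All z<u
  ι>0 : 0 < ι (P k) (z ∷ u) (maxExponent u n)
  ι>0 rewrite below-All z<u = P-maxExponent-positive u (<⇒≤ k<n) (Distinct-uninsert i d) (FireworksWord-uninsert i z<u f)

-- Degree and conclusion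

IsPerm⇒Distinct : ∀ {n} (w : Vec ℕ n) → IsPerm w → Distinct w
IsPerm⇒Distinct w p = fromList w (Permutation.Unique-resp-↭ (setoid ℕ) (↭⇒↭ₛ (↭-sym p)) (map⁺ suc-injective (upTo⁺ _)))
  where
  fromListAll : ∀ {k} {Q : ℕ → Set} (w : Vec ℕ k) → ListAll.All Q (toList w) → All Q w
  fromListAll [] [] = []
  fromListAll (x ∷ w) (q ∷ qs) = q ∷ fromListAll w qs
  fromList : ∀ {k} (w : Vec ℕ k) → Unique (toList w) → Distinct w
  fromList [] [] = []
  fromList (x ∷ w) (p ∷ u) = fromListAll w p ∷ fromList w u

size-mono : ∀ {n} {α β : Vec ℕ n} → α ≤ᶜ β → ∣ α ∣ₑ ≤ ∣ β ∣ₑ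
size-mono [] = z≤n
size-mono (a≤b ∷ α≤β) = +-mono-≤ a≤b (size-mono α≤β)

deg-≤ : ∀ {n} (f : Poly n) d → (∀ α → α ∈supp f → ∣ α ∣ₑ ≤ d) → deg f ≤ d
deg-≤ f d bound = go f
  where
  -- The filter tests coefficients of all of `f`, so the induction runs over a separate list `g`.
  go : ∀ g → List.foldr _⊔_ 0 (List.map (λ t → ∣ proj₂ t ∣ₑ) (filter (λ t → ¬? (coeff f (proj₂ t) ℤ.≟ 0ℤ)) g)) ≤ d
  go [] = z≤n
  go ((c , a) ∷ g) with coeff f a ℤ.≟ 0ℤ
  ... | yes _ = go g
  ... | no a∈f = ⊔-lub (bound a a∈f) (go g)

theorem3p15 : (n : ℕ) (w : Vec ℕ n) → IsPerm w → Fireworks w →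
    (α : Vec ℕ n) → α ∈supp groth w → ∣ α ∣ₑ < deg (groth w) →
    Σ (Vec ℕ n) (λ β → (β ∈supp groth w) × (α <ᶜ β))
theorem3p15 n w perm fw α α∈ α<deg with groth-P (n * n) w distinct (coinversions-≤ w)
  where distinct = IsPerm⇒Distinct w perm
... | (e , coeff≡) , bound = β , β∈ , ≤β α α∈ , α≢β
  where
  -- One witness serves every α: the greatest element of the support.
  β = maxExponent w n
  β∈ : β ∈supp groth w
  β∈ coeff≡0 = <⇒≢ (P-maxExponent-positive w ≤-refl (IsPerm⇒Distinct w perm) (Fireworks⇒FireworksWord w (IsPerm⇒Distinct w perm) fw))
    (sym (sign-*≡0 (e + ∣ β ∣ₑ) _ (trans (sym (coeff≡ β)) coeff≡0)))
  ≤β : ∀ γ → γ ∈supp groth w → γ ≤ᶜ β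
  ≤β γ γ∈ = bound γ λ P≡0 → γ∈ (trans (coeff≡ γ) (trans (cong (λ m → sign (e + ∣ γ ∣ₑ) ℤ.* + m) P≡0) (ℤₚ.*-zeroʳ (sign (e + ∣ γ ∣ₑ)))))
  α≢β : α ≢ β
  -- Since β dominates the support, the degree is at most |β|, whereas |α| lies below the degree.
  α≢β refl = <⇒≱ α<deg (deg-≤ (groth w) ∣ β ∣ₑ (λ γ γ∈ → size-mono (≤β γ γ∈)))
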